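{- Let $T$ be a tournament of order at least $5$ that is not a transitive tournament of even order. Then there exists $X\in \mathrm{tr}(T)$ such that $\mathrm{Inv}(T,X)$ is indecomposable. Moreover, $\delta'(T)=\Delta(T)$.
   Context: A tournament $T=(V(T),A(T))$ is a finite vertex set with, for every two distinct vertices $x,y$, exactly one of the arcs $(x,y),(y,x)$ in $A(T)$; its order is $|V(T)|$. $T$ is transitive if $(x,y),(y,z)\in A(T)$ implies $(x,z)\in A(T)$. For $X\subseteq V(T)$, $\overline X=V(T)\setminus X$, and $\mathrm{Inv}(T,X)$ is the tournament obtained from $T$ by reversing all arcs having both endpoints in $X$. A module of $T$ is a set $M\subseteq V(T)$ such that for all $x,y\in M$ and $v\in V(T)\setminus M$, $(v,x)\in A(T)$ if and only if $(v,y)\in A(T)$. The trivial modules are $\varnothing$, the singletons $\{u\}$ ($u\in V(T)$) and $V(T)$. $T$ is indecomposable if all its modules are trivial, and decomposable otherwise. $\mathcal M(T)$ denotes the set of nontrivial modules of $T$. A co-module of $T$ is a set $M\subseteq V(T)$ such that $M$ or $\overline M$ is a nontrivial module of $T$. $\mathrm{mc}(T)$ denotes the set of co-modules of $T$ that are minimal under inclusion among all co-modules of $T$. The co-modular index $\Delta(T)$ is the maximum size of a set of pairwise disjoint co-modules of $T$ (so $\Delta(T)=0$ if $T$ is indecomposable). Two sets $E,F$ overlap if $E\cap F$, $E\setminus F$ and $F\setminus E$ are all nonempty. Let $\mathcal F$ be a finite family of finite sets. $\mathcal F$ is strictly bipartite by a (finite) set $S$ if $S$ overlaps every element of $\mathcal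 F$. A transversal of $\mathcal F$ is a (finite) set $R$ with $F\cap R\ne\varnothing$ for every $F\in\mathcal F$; it is exact if $|F\cap R|=1$ for every $F\in\mathcal F$, and minimum if it has minimum size among transversals of $\mathcal F$. $\mathrm{tr}(T)$ denotes the set of all $R$ that are both exact and minimum transversals of $\mathrm{mc}(T)$ and such that $\mathcal M(T)$ is strictly bipartite by $R$. For $T$ of order at least $5$ that is not transitive of even order, the decomposability subtournament-index $\delta'(T)$ is the smallest integer $m$ for which there exists $X\subseteq V(T)$ with $|X|=m$ such that $\mathrm{Inv}(T,X)$ is indecomposable (existence of such an $X$ follows from the first assertion). -}

module Defs where

open import Data.Fin using (Fin)
open import Data.Fin.Subset
  using (Subset; _∈_; _∉_; _⊄_; _∩_; _─_; ∁; ∣_∣; ⁅_⁆; ⊥; ⊤; Nonempty; Empty)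
open import Data.Fin.Subset.Properties using (_∈?_)
open import Data.List using (List; length)
open import Data.List.Relation.Unary.All using (All)
open import Data.List.Relation.Unary.AllPairs using (AllPairs)
open import Data.List.Relation.Unary.Unique.Propositional using (Unique)
open import Data.Nat using (ℕ; _≤_)
open import Data.Nat.Properties using (≤-antisym)
open import Data.Product using (_×_; _,_; ∃-syntax)
open import Data.Sum using (_⊎_; inj₁; inj₂)
open import Function using (_⇔_)
open import Level using (0ℓ)
open import Relation.Binary.Core using (Rel)
open import Relation.Binary.Definitions
  using (Transitive; Trichotomous; tri<; tri≈; tri>)
open import Relation.Binary.PropositionalEquality using (_≡_)
open import Relation.Nullary using (¬_; yes; no; _×-dec_)
open import Relation.Unary using (Pred)

-- Trichotomy says that exactly one of (x , y), (y , x) is an arc when x ≢ y,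
-- and that there are no loops.
record Tournament (n : ℕ) : Set₁ where
  infix 4 _⟶_
  field
    _⟶_     : Rel (Fin n) 0ℓ
    compare : Trichotomous _≡_ _⟶_

private
  variable
    n : ℕ

IsTransitive : Tournament n → Set
IsTransitive T = Transitive (Tournament._⟶_ T)

Inv : Tournament n → Subset n → Tournament n
Inv {n} T X = record { _⟶_ = _⟶′_ ; compare = compare′ }
  where
  open Tournament T

  Both : Fin n → Fin n → Set
  Both x y = x ∈ X × y ∈ X

  _⟶′_ : Rel (Fin n) 0ℓ
  x ⟶′ y = (Both x y × y ⟶ x) ⊎ (¬ Both x y × x ⟶ y)

  reversed : ∀ {x y} → Both x y → ¬ y ⟶ x → ¬ x ⟶′ y
  reversed _ ¬yx (inj₁ (_ , yx)) = ¬yx yx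
  reversed b _   (inj₂ (¬b , _)) = ¬b b

  kept : ∀ {x y} → ¬ Both x y → ¬ x ⟶ y → ¬ x ⟶′ y
  kept ¬b _   (inj₁ (b , _))  = ¬b b
  kept _  ¬xy (inj₂ (_ , xy)) = ¬xy xy

  swap : ∀ {x y} → Both x y → Both y x
  swap (p , q) = q , p

  compare′ : Trichotomous _≡_ _⟶′_
  compare′ x y with (x ∈? X) ×-dec (y ∈? X) | compare x y
  ... | yes b | tri< xy x≢y ¬yx = tri> (reversed b ¬yx) x≢y (inj₁ (swap b , xy))
  ... | yes b | tri≈ ¬xy x≡y ¬yx = tri≈ (reversed b ¬yx) x≡y (reversed (swap b) ¬xy)
  ... | yes b | tri> ¬xy x≢y yx = tri< (inj₁ (b , yx)) x≢y (reversed (swap b) ¬xy)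
  ... | no ¬b | tri< xy x≢y ¬yx = tri< (inj₂ (¬b , xy)) x≢y (kept (λ b → ¬b (swap b)) ¬yx)
  ... | no ¬b | tri≈ ¬xy x≡y ¬yx = tri≈ (kept ¬b ¬xy) x≡y (kept (λ b → ¬b (swap b)) ¬yx)
  ... | no ¬b | tri> ¬xy x≢y yx = tri> (kept ¬b ¬xy) x≢y (inj₂ ((λ b → ¬b (swap b)) , yx))

module _ (T : Tournament n) where
  open Tournament T

  IsModule : Pred (Subset n) 0ℓ
  IsModule M = ∀ {x y v} → x ∈ M → y ∈ M → v ∉ M → (v ⟶ x) ⇔ (v ⟶ y)

IsTrivial : Pred (Subset n) 0ℓ
IsTrivial M = M ≡ ⊥ ⊎ (∃[ u ] M ≡ ⁅ u ⁆) ⊎ M ≡ ⊤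

Family : ℕ → Set₁
Family n = Pred (Subset n) 0ℓ

Overlap : Subset n → Subset n → Set
Overlap E F = Nonempty (E ∩ F) × Nonempty (E ─ F) × Nonempty (F ─ E)

StrictlyBipartiteBy : Family n → Subset n → Set
StrictlyBipartiteBy 𝓕 S = ∀ F → 𝓕 F → Overlap S F

-- Transversals are taken inside the ground set. This does not affect the
-- minimum ones, since deleting points outside it preserves transversality.
Transversal : Family n → Subset n → Set
Transversal 𝓕 R = ∀ F → 𝓕 F → Nonempty (F ∩ R)

ExactTransversal : Family n → Subset n → Set
ExactTransversal 𝓕 R = Transversal 𝓕 R × (∀ F → 𝓕 F → ∣ F ∩ R ∣ ≡ 1)

MinimumTransversal : Family n → Subset n → Set
MinimumTransversal 𝓕 R = Transversal 𝓕 R × (∀ S → Transversal 𝓕 S → ∣ R ∣ ≤ ∣ S ∣)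

IsGreatest IsLeast : Pred ℕ 0ℓ → Pred ℕ 0ℓ
IsGreatest P m = P m × (∀ k → P k → k ≤ m)
IsLeast    P m = P m × (∀ k → P k → m ≤ k)

IsGreatest-unique : ∀ {P i j} → IsGreatest P i → IsGreatest P j → i ≡ j
IsGreatest-unique (pi , maxi) (pj , maxj) = ≤-antisym (maxj _ pi) (maxi _ pj)

IsLeast-unique : ∀ {P i j} → IsLeast P i → IsLeast P j → i ≡ j
IsLeast-unique (pi , mini) (pj , minj) = ≤-antisym (mini _ pj) (minj _ pi)

module _ (T : Tournament n) where

  Indecomposable : Set
  Indecomposable = ∀ M → IsModule T M → IsTrivial M

  𝓜 : Family n
  𝓜 M = IsModule T M × ¬ IsTrivial M

  CoModule : Family n
  CoModule M = 𝓜 M ⊎ 𝓜 (∁ M)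

  mc : Family n
  mc M = CoModule M × (∀ N → CoModule N → N ⊄ M)

  tr : Family n
  tr R = ExactTransversal mc R × MinimumTransversal mc R × StrictlyBipartiteBy 𝓜 R

  -- A finite set of co-modules is a duplicate-free list.
  DisjointCoModules : List (Subset n) → Set
  DisjointCoModules Ms =
    Unique Ms × All CoModule Ms × AllPairs (λ M N → Empty (M ∩ N)) Ms

-- The two indices are given by their graphs: IsCoModularIndex T m means
-- Δ(T) = m, and IsDecomposabilityIndex T m means δ′(T) = m.

IsCoModularIndex : Tournament n → Pred ℕ 0ℓ
IsCoModularIndex T =
  IsGreatest (λ k → ∃[ Ms ] DisjointCoModules T Ms × length Ms ≡ k)

IsDecomposabilityIndex : Tournament n → Pred ℕ 0ℓ
IsDecomposabilityIndex T =
  IsLeast (λ k → ∃[ X ] ∣ X ∣ ≡ k × Indecomposable (Inv T X))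

{-# OPTIONS --safe #-}

-- Distinct minimal co-modules are disjoint, except that two-element modules (twins) may
-- share a vertex; these are the edges of disjoint paths. Taking alternate vertices on the
-- paths and one vertex in every other minimal co-module gives an exact transversal X together
-- with as many pairwise disjoint co-modules, so |X| = Δ(T), and no set inverting T to an
-- indecomposable tournament can be smaller, since it has to meet every co-module.
--
-- Suppose that Inv(T, X) has a nontrivial module M. Then M overlaps X, and the minimal
-- co-module of a vertex of X is so constrained by M that X ∩ M = {a} and X ∖ M = {c}. What
-- remains are three configurations, in all of which one of a, c lies in a minimal co-module N
-- that meets no other one. Its vertex in X may be replaced by any vertex of N, and as n ≥ 5,
-- not all of these choices can fail: following the failures from vertex to vertex of N gives
-- contradictory arcs.

module Submission where

open import Data.Bool using (Bool; true; false; not; _≟_; if_then_else_)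
open import Data.Bool.Properties using (not-¬; ¬-not; not-involutive)
open import Data.Empty using (⊥; ⊥-elim)
open import Data.Fin using (Fin)
open import Data.Fin.Properties using (any?; all?) renaming (_≟_ to _≟ᶠ_)
open import Data.Fin.Subset
  using (Subset; _∈_; _∉_; _⊆_; _⊂_; _∪_; _∩_; _─_; _-_; ∁; ∣_∣; ⁅_⁆; Nonempty; Empty)
  renaming (⊥ to ∅; ⊤ to full)
open import Data.Fin.Subset.Induction using (⊂-wellFounded; ⊃-wellFounded)
open import Data.Fin.Subset.Properties
open import Data.List using (List; []; _∷_; map; length)
open import Data.List.Properties using (length-map)
open import Data.List.Relation.Unary.All as All using (All; []; _∷_)
import Data.List.Relation.Unary.All.Properties as All
open import Data.List.Relation.Unary.AllPairs as AllPairs using (AllPairs; []; _∷_)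
import Data.List.Relation.Unary.AllPairs.Properties as AllPairs
open import Data.Nat using (ℕ; suc; _≤_; _+_; s≤s; z≤n)
open import Data.Nat.Divisibility using (_∣_; ∣m∣n⇒∣m+n; ∣-refl)
open import Data.Nat.Properties
  using (≤-trans; ≤-reflexive; +-mono-≤; +-monoʳ-≤; +-suc; <⇒≱; module ≤-Reasoning)
open import Data.Product using (_×_; _,_; proj₁; proj₂; ∃-syntax)
open import Data.Sum as Sum using (_⊎_; inj₁; inj₂; [_,_]′)
open import Data.Vec using (tabulate; []; _∷_; here; there)
open import Data.Vec.Properties using (lookup∘tabulate; lookup⇒[]=; []=⇒lookup; ≡-dec)
open import Function using (_∘_; mk⇔; Equivalence)
open import Induction.WellFounded using (WellFounded; Acc; acc; module Subrelation)
import Relation.Binary.Construct.On as On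
open import Relation.Binary.Definitions using (tri<; tri≈; tri>)
open import Relation.Binary.PropositionalEquality
  using (_≡_; _≢_; refl; sym; trans; cong; subst)
open import Relation.Nullary using (¬_; Dec; yes; no; does; _×-dec_; _⊎-dec_; _→-dec_; ¬?)
open import Relation.Nullary.Decidable using (map′; dec-true; decidable-stable)
open import Defs

-- Modules

-- Reversing the arcs inside X changes no arc between a set and its complement when X misses one of
-- the two. So a module of T survives unless X has vertices on both sides of it; this is why
-- co-modules, and not just modules, have to be met.
--
-- A module M of Inv(T, X) is so constrained because a vertex of X outside M has its arcs to M ∩ X
-- reversed and its arcs to the rest of M kept. In T it therefore separates these two parts of M,
-- while each minimal co-module, being a module or the complement of one, forbids separations. As X
-- meets it only once, the position of its other vertices is nearly forced.
--
-- The excluded tournaments arise from twin paths. A path running from the successor of a source to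
-- the predecessor of a sink must have both its ends skipped, for an end together with the source or
-- sink is a module that would lie inside X. Since every twin needs exactly one vertex of X, this
-- works only for an odd number of vertices on the path, that is, for odd order.

abstract

  sub : ∀ {n} {P : Fin n → Set} → (∀ x → Dec (P x)) → Subset n
  sub P? = tabulate (λ x → does (P? x))

  ∈sub⁺ : ∀ {n} {P : Fin n → Set} (P? : ∀ x → Dec (P x)) {x} → P x → x ∈ sub P?
  ∈sub⁺ P? {x} p = lookup⇒[]= x _ (trans (lookup∘tabulate _ x) (dec-true (P? x) p))

  ∈sub⁻ : ∀ {n} {P : Fin n → Set} (P? : ∀ x → Dec (P x)) {x} → x ∈ sub P? → P x
  ∈sub⁻ P? {x} x∈ with P? x | trans (sym (lookup∘tabulate (does ∘ P?) x)) ([]=⇒lookup x∈)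
  ... | yes p | _ = p
  ... | no _ | ()

∣p∪q∣≤ : ∀ {m} (p q : Subset m) → ∣ p ∪ q ∣ ≤ ∣ p ∣ + ∣ q ∣
∣p∪q∣≤ [] [] = z≤n
∣p∪q∣≤ (true ∷ p) (true ∷ q) = s≤s (≤-trans (∣p∪q∣≤ p q) (+-monoʳ-≤ ∣ p ∣ (∣p∣≤∣x∷p∣ true q)))
∣p∪q∣≤ (true ∷ p) (false ∷ q) = s≤s (∣p∪q∣≤ p q)
∣p∪q∣≤ (false ∷ p) (true ∷ q) = ≤-trans (s≤s (∣p∪q∣≤ p q)) (≤-reflexive (sym (+-suc ∣ p ∣ ∣ q ∣)))
∣p∪q∣≤ (false ∷ p) (false ∷ q) = ∣p∪q∣≤ p q

∣⁅x⁆∪p∣ : ∀ {m} {x : Fin m} {p : Subset m} → x ∉ p → ∣ ⁅ x ⁆ ∪ p ∣ ≡ suc ∣ p ∣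
∣⁅x⁆∪p∣ {x = Fin.zero} {true ∷ p} x∉ = ⊥-elim (x∉ here)
∣⁅x⁆∪p∣ {x = Fin.zero} {false ∷ p} x∉ = cong (suc ∘ ∣_∣) (∪-identityˡ p)
∣⁅x⁆∪p∣ {x = Fin.suc x} {true ∷ p} x∉ = cong suc (∣⁅x⁆∪p∣ (x∉ ∘ there))
∣⁅x⁆∪p∣ {x = Fin.suc x} {false ∷ p} x∉ = ∣⁅x⁆∪p∣ (x∉ ∘ there)

module _ {n : ℕ} where

  ∈∉⇒≢ : ∀ {x y : Fin n} {p} → x ∈ p → y ∉ p → x ≢ y
  ∈∉⇒≢ x∈ y∉ refl = y∉ x∈

  pair : Fin n → Fin n → Subset n
  pair x y = ⁅ x ⁆ ∪ ⁅ y ⁆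

  ∈²ˡ : ∀ {x y} → x ∈ pair x y
  ∈²ˡ {x} {y} = x∈p∪q⁺ (inj₁ (x∈⁅x⁆ x))

  ∈²ʳ : ∀ {x y} → y ∈ pair x y
  ∈²ʳ {x} {y} = x∈p∪q⁺ {p = ⁅ x ⁆} (inj₂ (x∈⁅x⁆ y))

  ∈²⁻ : ∀ {x y z} → z ∈ pair x y → z ≡ x ⊎ z ≡ y
  ∈²⁻ {x} {y} z∈ with x∈p∪q⁻ ⁅ x ⁆ ⁅ y ⁆ z∈
  ... | inj₁ h = inj₁ (x∈⁅y⁆⇒x≡y x h)
  ... | inj₂ h = inj₂ (x∈⁅y⁆⇒x≡y y h)

  ∉²⁺ : ∀ {x y z} → z ≢ x → z ≢ y → z ∉ pair x y
  ∉²⁺ z≢x z≢y = [ z≢x , z≢y ]′ ∘ ∈²⁻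

  fresh : 5 ≤ n → ∀ (a b c d : Fin n) → ∃[ x ] x ≢ a × x ≢ b × x ≢ c × x ≢ d
  fresh 5≤n a b c d
    with any? (λ x → ¬? (x ≟ᶠ a) ×-dec ¬? (x ≟ᶠ b) ×-dec ¬? (x ≟ᶠ c) ×-dec ¬? (x ≟ᶠ d))
  ... | yes h = h
  ... | no none = ⊥-elim (<⇒≱ 5≤n (begin
      n                                  ≡⟨ ∣⊤∣≡n n ⟨
      ∣ full {n} ∣                       ≤⟨ p⊆q⇒∣p∣≤∣q∣ {p = full} (λ {x} _ → covers x) ⟩
      ∣ pair a b ∪ pair c d ∣            ≤⟨ ∣p∪q∣≤ (pair a b) (pair c d) ⟩
      ∣ pair a b ∣ + ∣ pair c d ∣        ≤⟨ +-mono-≤ (two a b) (two c d) ⟩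
      4                                  ∎))
    where
    open ≤-Reasoning

    two : ∀ x y → ∣ pair x y ∣ ≤ 2
    two x y = begin
      ∣ pair x y ∣          ≤⟨ ∣p∪q∣≤ ⁅ x ⁆ ⁅ y ⁆ ⟩
      ∣ ⁅ x ⁆ ∣ + ∣ ⁅ y ⁆ ∣ ≤⟨ +-mono-≤ (≤-reflexive (∣⁅x⁆∣≡1 x)) (≤-reflexive (∣⁅x⁆∣≡1 y)) ⟩
      2                     ∎

    covers : ∀ x → x ∈ pair a b ∪ pair c d
    covers x with x ∈? pair a b | x ∈? pair c d
    ... | yes h | _ = x∈p∪q⁺ (inj₁ h)
    ... | no _ | yes h = x∈p∪q⁺ {p = pair a b} (inj₂ h)
    ... | no h | no h′ = ⊥-elim (none
      (x , (λ { refl → h ∈²ˡ }) , (λ { refl → h ∈²ʳ }) , (λ { refl → h′ ∈²ˡ }) , λ { refl → h′ ∈²ʳ }))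

module _ {n : ℕ} (T : Tournament n) where
  open Tournament T

  -- With Boolean arcs, a statement about arc u v ≡ s for a variable s covers T and its dual.
  arc : Fin n → Fin n → Bool
  arc u v with compare u v
  ... | tri< _ _ _ = true
  ... | tri≈ _ _ _ = false
  ... | tri> _ _ _ = false

  arc⁺ : ∀ {u v} → u ⟶ v → arc u v ≡ true
  arc⁺ {u} {v} uv with compare u v
  ... | tri< _ _ _ = refl
  ... | tri≈ ¬uv _ _ = ⊥-elim (¬uv uv)
  ... | tri> ¬uv _ _ = ⊥-elim (¬uv uv)

  arc⁻ : ∀ {u v} → arc u v ≡ true → u ⟶ v
  arc⁻ {u} {v} h with compare u v
  arc⁻ _ | tri< uv _ _ = uv
  arc⁻ () | tri≈ _ _ _
  arc⁻ () | tri> _ _ _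

  arc-irrefl : ∀ {u} → arc u u ≡ false
  arc-irrefl {u} with compare u u
  ... | tri< _ u≢u _ = ⊥-elim (u≢u refl)
  ... | tri≈ _ _ _ = refl
  ... | tri> _ _ _ = refl

  arc-flip : ∀ {u v s} → u ≢ v → arc u v ≡ s → arc v u ≡ not s
  arc-flip {u} {v} u≢v refl with compare u v | compare v u
  ... | tri< _ _ _ | tri> _ _ _ = refl
  ... | tri> _ _ _ | tri< _ _ _ = refl
  ... | tri< uv _ _ | tri< _ _ ¬uv = ⊥-elim (¬uv uv)
  ... | tri> _ _ vu | tri> ¬vu _ _ = ⊥-elim (¬vu vu)
  ... | tri≈ _ u≡v _ | _ = ⊥-elim (u≢v u≡v)
  ... | tri< _ _ _ | tri≈ _ v≡u _ = ⊥-elim (u≢v (sym v≡u))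
  ... | tri> _ _ _ | tri≈ _ v≡u _ = ⊥-elim (u≢v (sym v≡u))

  arc-flip′ : ∀ {u v s} → u ≢ v → arc u v ≡ not s → arc v u ≡ s
  arc-flip′ {s = s} u≢v h = trans (arc-flip u≢v h) (not-involutive s)

  Uniform : Subset n → Set
  Uniform M = ∀ {x y v} → x ∈ M → y ∈ M → v ∉ M → arc v x ≡ arc v y

arc-cong : ∀ {n} (T U : Tournament n) {u v x y} →
  (Tournament._⟶_ T u v → Tournament._⟶_ U x y) → (Tournament._⟶_ U x y → Tournament._⟶_ T u v) →
  arc T u v ≡ arc U x y
arc-cong T U {u} {v} {x} {y} f g with arc T u v in p | arc U x y in q
... | true | true = refl
... | false | false = refl
... | true | false = trans (sym (arc⁺ U (f (arc⁻ T p)))) q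
... | false | true = trans (sym p) (arc⁺ T (g (arc⁻ U q)))

module _ {n : ℕ} (T : Tournament n) where

  module⇒uniform : ∀ {M} → IsModule T M → Uniform T M
  module⇒uniform mod x∈ y∈ v∉ = arc-cong T T (Equivalence.to (mod x∈ y∈ v∉)) (Equivalence.from (mod x∈ y∈ v∉))

  uniform⇒module : ∀ {M} → Uniform T M → IsModule T M
  uniform⇒module uni x∈ y∈ v∉ =
    mk⇔ (λ vx → arc⁻ T (trans (sym (uni x∈ y∈ v∉)) (arc⁺ T vx)))
        (λ vy → arc⁻ T (trans (uni x∈ y∈ v∉) (arc⁺ T vy)))

  -- The vertices `p`, `q`, `r` refute the three trivial shapes. With Boolean arcs the notion is
  -- decidable, which licenses all the later arguments by contradiction.
  record NontrivialModule (M : Subset n) : Set where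
    constructor nontrivial
    field
      uniform : Uniform T M
      {p q r} : Fin n
      p∈ : p ∈ M
      q∈ : q ∈ M
      p≢q : p ≢ q
      r∉ : r ∉ M

  nontrivial? : ∀ M → Dec (NontrivialModule M)
  nontrivial? M = map′
    (λ (u , p , q , r , p∈ , q∈ , p≢q , r∉) → nontrivial (λ {x} {y} {v} → u x y v) p∈ q∈ p≢q r∉)
    (λ (nontrivial u p∈ q∈ p≢q r∉) → (λ x y v → u {x} {y} {v}) , _ , _ , _ , p∈ , q∈ , p≢q , r∉)
    (all? (λ x → all? λ y → all? λ v →
       (x ∈? M) →-dec ((y ∈? M) →-dec (¬? (v ∈? M) →-dec (arc T v x ≟ arc T v y))))
     ×-dec any? λ p → any? λ q → any? λ r →
       (p ∈? M) ×-dec (q ∈? M) ×-dec ¬? (p ≟ᶠ q) ×-dec ¬? (r ∈? M))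

  nontrivial⇒𝓜 : ∀ {M} → NontrivialModule M → 𝓜 T M
  nontrivial⇒𝓜 (nontrivial u p∈ q∈ p≢q r∉) = uniform⇒module u ,
    λ { (inj₁ refl) → ∉⊥ p∈
      ; (inj₂ (inj₁ (w , refl))) → p≢q (trans (x∈⁅y⁆⇒x≡y w p∈) (sym (x∈⁅y⁆⇒x≡y w q∈)))
      ; (inj₂ (inj₂ refl)) → r∉ ∈⊤ }

  trivial⊎nontrivial : ∀ {M} → IsModule T M → IsTrivial M ⊎ NontrivialModule M
  trivial⊎nontrivial {M} mod with nonempty? M
  ... | no none = inj₁ (inj₁ (Empty-unique none))
  ... | yes (p , p∈) with any? (λ r → ¬? (r ∈? M))
  ... | no none = inj₁ (inj₂ (inj₂ (⊆-antisym ⊆⊤ λ {x} _ → decidable-stable (x ∈? M) λ x∉ → none (x , x∉))))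
  ... | yes (r , r∉) with any? (λ q → (q ∈? M) ×-dec ¬? (p ≟ᶠ q))
  ... | yes (q , q∈ , p≢q) = inj₂ (nontrivial (module⇒uniform mod) p∈ q∈ p≢q r∉)
  ... | no none = inj₁ (inj₂ (inj₁ (p , ⊆-antisym
      (λ {q} q∈ → subst (_∈ ⁅ p ⁆) (decidable-stable (p ≟ᶠ q) (λ p≢q → none (q , q∈ , p≢q))) (x∈⁅x⁆ p))
      (λ q∈ → subst (_∈ M) (sym (x∈⁅y⁆⇒x≡y p q∈)) p∈))))

  𝓜⇒nontrivial : ∀ {M} → 𝓜 T M → NontrivialModule M
  𝓜⇒nontrivial (mod , ¬triv) = [ (λ t → ⊥-elim (¬triv t)) , (λ h → h) ]′ (trivial⊎nontrivial mod)

  comodule? : ∀ M → Dec (CoModule T M)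
  comodule? M = map′
    [ inj₁ ∘ nontrivial⇒𝓜 , inj₂ ∘ nontrivial⇒𝓜 ]′ [ inj₁ ∘ 𝓜⇒nontrivial , inj₂ ∘ 𝓜⇒nontrivial ]′
    (nontrivial? M ⊎-dec nontrivial? (∁ M))

  mc-minimal : ∀ {M N} → mc T N → CoModule T M → M ⊆ N → N ⊆ M
  mc-minimal {M} (_ , min) co M⊆N {x} x∈N =
    decidable-stable (x ∈? M) λ x∉M → min M co (M⊆N , x , x∈N , x∉M)

  mc? : ∀ N → Dec (mc T N)
  mc? N = comodule? N ×-dec map′
    (λ none M co M⊂N → none (M , co , M⊂N)) (λ min (M , co , M⊂N) → min M co M⊂N)
    (¬? (anySubset? λ M → comodule? M ×-dec (M ⊂? N)))

  mc-below : ∀ {M} → CoModule T M → ∃[ N ] mc T N × N ⊆ M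
  mc-below {M} = go (⊂-wellFounded M)
    where
    go : ∀ {M} → Acc _⊂_ M → CoModule T M → ∃[ N ] mc T N × N ⊆ M
    go {M} (acc rec) co with anySubset? (λ N → comodule? N ×-dec (N ⊂? M))
    ... | no none = M , (co , λ N co′ N⊂M → none (N , co′ , N⊂M)) , λ x∈ → x∈
    ... | yes (N , co′ , N⊂M) with go (rec N⊂M) co′
    ... | K , mcK , K⊆N = K , mcK , λ x∈ → proj₁ N⊂M (K⊆N x∈)

-- Minimal co-modules

module _ {n : ℕ} {p q : Subset n} where

  ∈─⁻ : ∀ {x} → x ∈ p ─ q → x ∈ p × x ∉ q
  ∈─⁻ {x} x∈ = p─q⊆p p q x∈ , λ x∈q → go p q x∈ x∈q
    where
    go : ∀ {m} (p q : Subset m) {x} → x ∈ p ─ q → x ∉ q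
    go (_ ∷ p) (true ∷ q) (there x∈) (there x∈q) = go p q x∈ x∈q
    go (_ ∷ p) (false ∷ q) (there x∈) (there x∈q) = go p q x∈ x∈q

  ∉∪⁻ : ∀ {x} → x ∉ p ∪ q → x ∉ p × x ∉ q
  ∉∪⁻ x∉ = x∉ ∘ x∈p∪q⁺ ∘ inj₁ , x∉ ∘ x∈p∪q⁺ ∘ inj₂

module _ {n : ℕ} (T : Tournament n) where

  uniform-flip : ∀ {M} → Uniform T M → ∀ {x y v} → x ∈ M → y ∈ M → v ∉ M → arc T x v ≡ arc T y v
  uniform-flip uni x∈ y∈ v∉ =
    trans (arc-flip T (∈∉⇒≢ x∈ v∉ ∘ sym) (uni x∈ y∈ v∉)) (sym (arc-flip T (∈∉⇒≢ y∈ v∉ ∘ sym) refl))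

  ∪-uniform : ∀ {P Q} → Uniform T P → Uniform T Q → ∀ {z} → z ∈ P → z ∈ Q → Uniform T (P ∪ Q)
  ∪-uniform {P} {Q} uP uQ {z} zP zQ {v = v} x∈ y∈ v∉ = trans (to-z x∈) (sym (to-z y∈))
    where
    to-z : ∀ {x} → x ∈ P ∪ Q → arc T v x ≡ arc T v z
    to-z x∈ = [ (λ x∈P → uP x∈P zP (proj₁ (∉∪⁻ v∉))) , (λ x∈Q → uQ x∈Q zQ (proj₂ (∉∪⁻ v∉))) ]′ (x∈p∪q⁻ P Q x∈)

  ∩-uniform : ∀ {P Q} → Uniform T P → Uniform T Q → Uniform T (P ∩ Q)
  ∩-uniform {P} {Q} uP uQ {v = v} x∈ y∈ v∉ with v ∈? P | x∈p∩q⁻ P Q x∈ | x∈p∩q⁻ P Q y∈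
  ... | yes v∈P | _ , xQ | _ , yQ = uQ xQ yQ (λ v∈Q → v∉ (x∈p∩q⁺ (v∈P , v∈Q)))
  ... | no v∉P | xP , _ | yP , _ = uP xP yP v∉P

  -- A vertex v of P ∩ Q is exchanged, inside the module Q, for z, which lies outside P and sees P
  -- uniformly.
  ─-uniform : ∀ {P Q} → Uniform T P → Uniform T Q → ∀ {z} → z ∈ Q → z ∉ P → Uniform T (P ─ Q)
  ─-uniform {P} {Q} uP uQ {z} zQ z∉P {v = v} x∈ y∈ v∉ with v ∈? P | ∈─⁻ x∈ | ∈─⁻ y∈
  ... | no v∉P | xP , _ | yP , _ = uP xP yP v∉P
  ... | yes v∈P | xP , x∉Q | yP , y∉Q =
    trans (uniform-flip uQ v∈Q zQ x∉Q) (trans (uP xP yP z∉P) (uniform-flip uQ zQ v∈Q y∉Q))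
    where
    v∈Q : v ∈ Q
    v∈Q = decidable-stable (v ∈? Q) (v∉ ∘ x∈p∧x∉q⇒x∈p─q v∈P)

  nontrivial⇒comodule : ∀ {M} → NontrivialModule T M → CoModule T M
  nontrivial⇒comodule = inj₁ ∘ nontrivial⇒𝓜 T

  nontrivial∁⇒comodule : ∀ {M} → NontrivialModule T (∁ M) → CoModule T M
  nontrivial∁⇒comodule = inj₂ ∘ nontrivial⇒𝓜 T

  nontrivial⇒comodule∁ : ∀ {M} → NontrivialModule T M → CoModule T (∁ M)
  nontrivial⇒comodule∁ {M} m = nontrivial∁⇒comodule (subst (NontrivialModule T) (sym (∁∁ M)) m)
    where
    ∁∁ : ∀ {m} (p : Subset m) → ∁ (∁ p) ≡ p
    ∁∁ [] = refl
    ∁∁ (true ∷ p) = cong (true ∷_) (∁∁ p)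
    ∁∁ (false ∷ p) = cong (false ∷_) (∁∁ p)

  mc-cases : ∀ {N} → mc T N → NontrivialModule T N ⊎ NontrivialModule T (∁ N)
  mc-cases (inj₁ m , _) = inj₁ (𝓜⇒nontrivial T m)
  mc-cases (inj₂ m , _) = inj₂ (𝓜⇒nontrivial T m)

  mc-∃∉ : ∀ {N N′} → mc T N → mc T N′ → N ≢ N′ → ∃[ u ] u ∈ N × u ∉ N′
  mc-∃∉ {N} {N′} mcN mcN′ N≢N′ with any? (λ u → (u ∈? N) ×-dec ¬? (u ∈? N′))
  ... | yes h = h
  ... | no none = ⊥-elim (N≢N′ (⊆-antisym N⊆N′ (mc-minimal T mcN′ (proj₁ mcN) N⊆N′)))
    where
    N⊆N′ : N ⊆ N′
    N⊆N′ {u} u∈ = decidable-stable (u ∈? N′) λ u∉ → none (u , u∈ , u∉)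

  mc-avoid : ∀ {M N w} → mc T N → CoModule T M → M ⊆ N → w ∈ N → w ∉ M → ⊥
  mc-avoid mcN co M⊆N w∈N w∉M = w∉M (mc-minimal T mcN co M⊆N w∈N)

  private
    -- `N ∪ ∁ N′` is a module, and its complement is a co-module properly inside N′, because x is
    -- lost.
    module–comodule : ∀ {N N′ x} → mc T N → mc T N′ → N ≢ N′ → x ∈ N → x ∈ N′ →
      NontrivialModule T N → NontrivialModule T (∁ N′) → ⊥
    module–comodule {N} {N′} {x} mcN mcN′ N≢N′ x∈N x∈N′ nt nt′ =
      mc-avoid mcN′ (nontrivial⇒comodule∁ union) below x∈N′ (λ h → x∈∁p⇒x∉p h (x∈p∪q⁺ (inj₁ x∈N)))
      where
      u = proj₁ (mc-∃∉ mcN mcN′ N≢N′)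
      u∈N = proj₁ (proj₂ (mc-∃∉ mcN mcN′ N≢N′))
      u∉N′ = proj₂ (proj₂ (mc-∃∉ mcN mcN′ N≢N′))
      w = proj₁ (mc-∃∉ mcN′ mcN (N≢N′ ∘ sym))
      w∈N′ = proj₁ (proj₂ (mc-∃∉ mcN′ mcN (N≢N′ ∘ sym)))
      w∉N = proj₂ (proj₂ (mc-∃∉ mcN′ mcN (N≢N′ ∘ sym)))

      open NontrivialModule

      union : NontrivialModule T (N ∪ ∁ N′)
      union = nontrivial (∪-uniform (uniform nt) (uniform nt′) u∈N (x∉p⇒x∈∁p u∉N′))
        (x∈p∪q⁺ (inj₁ (p∈ nt))) (x∈p∪q⁺ (inj₁ (q∈ nt))) (p≢q nt)
        ([ w∉N , x∈p⇒x∉∁p w∈N′ ]′ ∘ x∈p∪q⁻ N (∁ N′))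

      below : ∁ (N ∪ ∁ N′) ⊆ N′
      below h = x∉∁p⇒x∈p (proj₂ (∉∪⁻ (x∈∁p⇒x∉p h)))

    -- If some vertex avoids both sets, `∁ N ∪ ∁ N′` is a module whose complement N ∩ N′ lies
    -- properly inside N. Otherwise ∁ N is itself a co-module properly inside N′.
    comodule–comodule : ∀ {N N′ x} → mc T N → mc T N′ → N ≢ N′ → x ∈ N → x ∈ N′ →
      NontrivialModule T (∁ N) → NontrivialModule T (∁ N′) → ⊥
    comodule–comodule {N} {N′} {x} mcN mcN′ N≢N′ x∈N x∈N′ nt nt′
      with any? (λ z → ¬? (z ∈? N) ×-dec ¬? (z ∈? N′)) | mc-∃∉ mcN mcN′ N≢N′
    ... | no none | _ =
      x∈p⇒x∉∁p x∈N (mc-minimal T mcN′ (nontrivial⇒comodule nt)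
        (λ {z} z∈ → decidable-stable (z ∈? N′) λ z∉ → none (z , x∈∁p⇒x∉p z∈ , z∉)) x∈N′)
    ... | yes (z , z∉N , z∉N′) | u , u∈N , u∉N′ =
      mc-avoid mcN (nontrivial⇒comodule∁ union) below u∈N (λ h → x∈∁p⇒x∉p h (x∈p∪q⁺ (inj₂ (x∉p⇒x∈∁p u∉N′))))
      where
      open NontrivialModule

      union : NontrivialModule T (∁ N ∪ ∁ N′)
      union = nontrivial (∪-uniform (uniform nt) (uniform nt′) (x∉p⇒x∈∁p z∉N) (x∉p⇒x∈∁p z∉N′))
        (x∈p∪q⁺ (inj₁ (p∈ nt))) (x∈p∪q⁺ (inj₁ (q∈ nt))) (p≢q nt)
        ([ x∈p⇒x∉∁p x∈N , x∈p⇒x∉∁p x∈N′ ]′ ∘ x∈p∪q⁻ (∁ N) (∁ N′))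

      below : ∁ (∁ N ∪ ∁ N′) ⊆ N
      below h = x∉∁p⇒x∈p (proj₁ (∉∪⁻ (x∈∁p⇒x∉p h)))

  -- When both are modules, `N ∩ N′` and `N ─ N′` are uniform and properly inside N, hence
  -- singletons by minimality. The cases involving a complement are excluded by the two preceding
  -- lemmas.
  mc-meeting : ∀ {N N′ x} → mc T N → mc T N′ → N ≢ N′ → x ∈ N → x ∈ N′ →
    NontrivialModule T N × ∃[ u ] u ∈ N × u ∉ N′ × (∀ {y} → y ∈ N → y ≡ u ⊎ y ≡ x)
  mc-meeting {N} {N′} {x} mcN mcN′ N≢N′ x∈N x∈N′ with mc-cases mcN | mc-cases mcN′
  ... | inj₂ c | inj₂ c′ = ⊥-elim (comodule–comodule mcN mcN′ N≢N′ x∈N x∈N′ c c′)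
  ... | inj₁ m | inj₂ c′ = ⊥-elim (module–comodule mcN mcN′ N≢N′ x∈N x∈N′ m c′)
  ... | inj₂ c | inj₁ m′ = ⊥-elim (module–comodule mcN′ mcN (N≢N′ ∘ sym) x∈N′ x∈N m′ c)
  ... | inj₁ m | inj₁ m′ with mc-∃∉ mcN mcN′ N≢N′ | mc-∃∉ mcN′ mcN (N≢N′ ∘ sym)
  ... | u , u∈N , u∉N′ | w , w∈N′ , w∉N = m , u , u∈N , u∉N′ , λ {y} y∈ → classify y y∈ (y ∈? N′)
    where
    open NontrivialModule

    classify : ∀ y → y ∈ N → Dec (y ∈ N′) → y ≡ u ⊎ y ≡ x
    classify y y∈ (yes y∈N′) = inj₂ (decidable-stable (y ≟ᶠ x) λ y≢x →
      mc-avoid mcN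
        (nontrivial⇒comodule (nontrivial (∩-uniform (uniform m) (uniform m′))
          (x∈p∩q⁺ (y∈ , y∈N′)) (x∈p∩q⁺ (x∈N , x∈N′)) y≢x (λ h → u∉N′ (proj₂ (x∈p∩q⁻ N N′ h)))))
        (p∩q⊆p N N′) u∈N (λ h → u∉N′ (proj₂ (x∈p∩q⁻ N N′ h))))
    classify y y∈ (no y∉N′) = inj₁ (decidable-stable (y ≟ᶠ u) λ y≢u →
      mc-avoid mcN
        (nontrivial⇒comodule (nontrivial (─-uniform (uniform m) (uniform m′) w∈N′ w∉N)
          (x∈p∧x∉q⇒x∈p─q y∈ y∉N′) (x∈p∧x∉q⇒x∈p─q u∈N u∉N′) y≢u (λ h → proj₂ (∈─⁻ h) x∈N′)))
        (p─q⊆p N N′) x∈N (λ h → proj₂ (∈─⁻ h) x∈N′))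

  -- A vertex of N′ sees N uniformly because N lies in the module ∁ N′. Any other vertex outside N
  -- is exchanged, inside the module ∁ N, for a vertex of N′.
  disjoint-comodules-uniform : ∀ {N N′} → NontrivialModule T (∁ N) → NontrivialModule T (∁ N′) →
    (∀ {v} → v ∈ N → v ∉ N′) → Uniform T N
  disjoint-comodules-uniform {N} {N′} c c′ disj {x} {y} {v} x∈ y∈ v∉ with v ∈? N′
  ... | yes v∈N′ = uniform c′ (x∉p⇒x∈∁p (disj x∈)) (x∉p⇒x∈∁p (disj y∈)) (x∈p⇒x∉∁p v∈N′)
    where open NontrivialModule
  ... | no v∉N′ =
    trans (uniform-flip (uniform c) v∈ w∈ (x∈p⇒x∉∁p x∈))
      (trans (uniform c′ (x∉p⇒x∈∁p (disj x∈)) (x∉p⇒x∈∁p (disj y∈)) (x∈p⇒x∉∁p w∈N′))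
        (uniform-flip (uniform c) w∈ v∈ (x∈p⇒x∉∁p y∈)))
    where
    open NontrivialModule
    w∈N′ : r c′ ∈ N′
    w∈N′ = x∉∁p⇒x∈p (r∉ c′)
    v∈ : v ∈ ∁ N
    v∈ = x∉p⇒x∈∁p v∉
    w∈ : r c′ ∈ ∁ N
    w∈ = x∉p⇒x∈∁p (λ h → disj h w∈N′)

-- Modules surviving an inversion

module _ {n : ℕ} (T : Tournament n) where

  -- Everything that a replacement of a vertex has to preserve. The disjoint `rep x` form a packing
  -- of size |X|, a lower bound for Δ(T) and for all transversals; `meets`, also applied below
  -- complements of modules, and `covers` give strict bipartiteness.
  record Valid (X : Subset n) : Set where
    field
      rep    : Fin n → Subset n
      rep-mc : ∀ {x} → x ∈ X → mc T (rep x)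
      ∈rep   : ∀ {x} → x ∈ X → x ∈ rep x
      disj   : ∀ {x y v} → x ∈ X → y ∈ X → x ≢ y → v ∈ rep x → v ∉ rep y
      meets  : ∀ {N} → mc T N → ∃[ x ] x ∈ X × x ∈ N
      once   : ∀ {N x y} → mc T N → x ∈ X → y ∈ X → x ∈ N → y ∈ N → x ≡ y
      covers : ∀ {M} → NontrivialModule T M → ∃[ y ] y ∈ M × y ∉ X

    rep-once : ∀ {x y} → x ∈ X → y ∈ X → y ∈ rep x → y ≡ x
    rep-once x∈ y∈ y∈rep = once (rep-mc x∈) y∈ x∈ y∈rep (∈rep x∈)

    meets-comodule : ∀ {M} → CoModule T M → ∃[ x ] x ∈ X × x ∈ M
    meets-comodule co with mc-below T co
    ... | N , mcN , N⊆M with meets mcN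
    ... | x , x∈X , x∈N = x , x∈X , N⊆M x∈N

    meets-module : ∀ {M} → NontrivialModule T M → ∃[ x ] x ∈ X × x ∈ M
    meets-module = meets-comodule ∘ nontrivial⇒comodule T

    meets-outside : ∀ {M} → NontrivialModule T M → ∃[ x ] x ∈ X × x ∉ M
    meets-outside m with meets-comodule (nontrivial⇒comodule∁ T m)
    ... | x , x∈X , x∈∁ = x , x∈X , x∈∁p⇒x∉p x∈∁

  -- The three ways in which Inv(T, X) can have a nontrivial module M. In each of them
  -- X = {a , c} with a ∈ M and c ∉ M, and P, N are the minimal co-modules of a and c.
  data Obstruction (P N : Subset n) (a c : Fin n) : Set where
    extreme : ∀ s b →
      (∀ {x} → x ≢ a → arc T a x ≡ s) →
      (∀ {x} → x ≢ a → x ∈ N) →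
      NontrivialModule T N →
      arc T c b ≡ s → b ≢ a → b ≢ c →
      (∀ {x} → x ≢ a → x ≢ b → x ≢ c → arc T b x ≡ s) →
      Obstruction P N a c
    outer-c : ∀ b →
      ¬ NontrivialModule T N → NontrivialModule T P →
      b ∈ N → b ≢ c →
      (∀ {d} → d ∈ P → d ≢ a → arc T b a ≡ arc T a d) →
      (∀ {v} → v ≢ a → v ≢ b → v ≢ c → arc T v a ≡ arc T v b) →
      arc T c a ≢ arc T c b →
      Obstruction P N a c
    outer-a : ∀ s b →
      ¬ NontrivialModule T P → NontrivialModule T N →
      b ∈ N → b ≢ c →
      (∀ {x} → x ∉ P → x ≡ c ⊎ x ≡ b) →
      arc T a c ≡ s → arc T c b ≡ s →
      (∀ {v} → v ∈ P → v ≢ a → arc T v c ≡ not s) →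
      Obstruction P N a c

  inv-kept : ∀ X {u v} → ¬ (u ∈ X × v ∈ X) → arc (Inv T X) u v ≡ arc T u v
  inv-kept X ¬b = arc-cong (Inv T X) T
    (λ { (inj₁ (b , _)) → ⊥-elim (¬b b) ; (inj₂ (_ , uv)) → uv }) (λ uv → inj₂ (¬b , uv))

  inv-both : ∀ X {u v} → u ∈ X → v ∈ X → arc (Inv T X) u v ≡ arc T v u
  inv-both X u∈ v∈ = arc-cong (Inv T X) T
    (λ { (inj₁ (_ , vu)) → vu ; (inj₂ (¬b , _)) → ⊥-elim (¬b (u∈ , v∈)) }) (λ vu → inj₁ ((u∈ , v∈) , vu))

  other : ∀ {N} → NontrivialModule T N → ∀ a → ∃[ d ] d ∈ N × d ≢ a
  other (nontrivial _ {p} {q} p∈ q∈ p≢q _) a with p ≟ᶠ a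
  ... | yes refl = q , q∈ , p≢q ∘ sym
  ... | no p≢a = p , p∈ , p≢a

-- Structure of a surviving module

module Survivor {n : ℕ} (T : Tournament n) {X : Subset n} (V : Valid T X)
  {M : Subset n} (bad : NontrivialModule (Inv T X) M) where
  open Valid V
  open NontrivialModule

  -- Put A = M ∩ X, B = M ∖ X, C = X ∖ M, and let D be the set of the remaining vertices.

  private
    flip : ∀ {u v s} → u ≢ v → arc T u v ≡ s → arc T v u ≡ not s
    flip = arc-flip T

    clash : ∀ {b s : Bool} → b ≡ s → b ≡ not s → ⊥
    clash p q = not-¬ p q

  kept : ∀ {v x y} → v ∉ M → x ∈ M → y ∈ M → ¬ (v ∈ X × x ∈ X) → ¬ (v ∈ X × y ∈ X) → arc T v x ≡ arc T v y
  kept v∉ x∈ y∈ ¬vx ¬vy = trans (sym (inv-kept T X ¬vx)) (trans (uniform bad x∈ y∈ v∉) (inv-kept T X ¬vy))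

  uniform-D : ∀ {v x y} → v ∉ M → v ∉ X → x ∈ M → y ∈ M → arc T v x ≡ arc T v y
  uniform-D v∉ v∉X x∈ y∈ = kept v∉ x∈ y∈ (v∉X ∘ proj₁) (v∉X ∘ proj₁)

  uniform-D′ : ∀ {v x y} → v ∉ M → v ∉ X → x ∈ M → y ∈ M → arc T x v ≡ arc T y v
  uniform-D′ v∉ v∉X x∈ y∈ =
    trans (flip (∈∉⇒≢ x∈ v∉ ∘ sym) (uniform-D v∉ v∉X x∈ y∈)) (sym (flip (∈∉⇒≢ y∈ v∉ ∘ sym) refl))

  uniform-B : ∀ {v x y} → v ∉ M → x ∈ M → x ∉ X → y ∈ M → y ∉ X → arc T v x ≡ arc T v y
  uniform-B v∉ x∈ x∉X y∈ y∉X = kept v∉ x∈ y∈ (x∉X ∘ proj₂) (y∉X ∘ proj₂)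

  uniform-A : ∀ {v x y} → v ∉ M → x ∈ M → x ∈ X → y ∈ M → y ∈ X → arc T v x ≡ arc T v y
  uniform-A {v} {x} {y} v∉ x∈ x∈X y∈ y∈X with v ∈? X
  ... | no v∉X = uniform-D v∉ v∉X x∈ y∈
  ... | yes v∈X =
    trans (flip (∈∉⇒≢ x∈ v∉) xv≡yv) (sym (flip (∈∉⇒≢ y∈ v∉) refl))
    where
    xv≡yv : arc T x v ≡ arc T y v
    xv≡yv = trans (sym (inv-both T X v∈X x∈X)) (trans (uniform bad x∈ y∈ v∉) (inv-both T X v∈X y∈X))

  -- Where the inversion matters: a vertex of C has its arcs to A reversed and its arcs to B kept,
  -- so in T it separates A from B.
  opposite : ∀ {v x y} → v ∉ M → v ∈ X → x ∈ M → x ∈ X → y ∈ M → y ∉ X → arc T x v ≡ arc T v y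
  opposite v∉ v∈X x∈ x∈X y∈ y∉X =
    trans (sym (inv-both T X v∈X x∈X)) (trans (uniform bad x∈ y∈ v∉) (inv-kept T X (y∉X ∘ proj₂)))

  -- If M missed X, all arcs between M and its complement would be kept, so M would be a module of
  -- T, which X has to meet.
  ∃A : ∃[ a ] a ∈ M × a ∈ X
  ∃A with any? (λ a → (a ∈? M) ×-dec (a ∈? X))
  ... | yes h = h
  ... | no none with meets-module (nontrivial
        (λ x∈ y∈ v∉ → uniform-B v∉ x∈ (λ h → none (_ , x∈ , h)) y∈ (λ h → none (_ , y∈ , h)))
        (p∈ bad) (q∈ bad) (p≢q bad) (r∉ bad))
  ... | w , w∈X , w∈M = ⊥-elim (none (w , w∈M , w∈X))

  -- If M lay inside X, each outside vertex would have its arcs to M all reversed or all kept. Then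
  -- M would be a module of T, against `covers`.
  ∃B : ∃[ b ] b ∈ M × b ∉ X
  ∃B with any? (λ b → (b ∈? M) ×-dec ¬? (b ∈? X))
  ... | yes h = h
  ... | no none = ⊥-elim (none (covers (nontrivial
        (λ x∈ y∈ v∉ → uniform-A v∉ x∈ (in-X x∈) y∈ (in-X y∈)) (p∈ bad) (q∈ bad) (p≢q bad) (r∉ bad))))
    where
    in-X : ∀ {x} → x ∈ M → x ∈ X
    in-X {x} x∈ = decidable-stable (x ∈? X) λ h → none (x , x∈ , h)

  -- If X lay inside M, no arc leaving or entering M would change, so M would be a module of T
  -- containing X.
  ∃C : ∃[ c ] c ∉ M × c ∈ X
  ∃C with any? (λ c → ¬? (c ∈? M) ×-dec (c ∈? X))
  ... | yes h = h
  ... | no none with meets-outside (nontrivial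
        (λ x∈ y∈ v∉ → uniform-D v∉ (λ h → none (_ , v∉ , h)) x∈ y∈)
        (p∈ bad) (q∈ bad) (p≢q bad) (r∉ bad))
  ... | w , w∈X , w∉M = ⊥-elim (none (w , w∉M , w∈X))

  module At {a₀ b₀ c₀ : Fin n} (a₀∈M : a₀ ∈ M) (a₀∈X : a₀ ∈ X) (b₀∈M : b₀ ∈ M) (b₀∉X : b₀ ∉ X)
    (c₀∉M : c₀ ∉ M) (c₀∈X : c₀ ∈ X) where

    a₀≢c₀ : a₀ ≢ c₀
    a₀≢c₀ = ∈∉⇒≢ a₀∈M c₀∉M

    -- For c in C, `true` means A → c → B in T, and `false` means B → c → A; see `sign-A` and
    -- `sign-B`.
    sign : Fin n → Bool
    sign c = arc T a₀ c

    sign-B : ∀ {c b} → c ∉ M → c ∈ X → b ∈ M → b ∉ X → arc T c b ≡ sign c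
    sign-B c∉ c∈X b∈ b∉X = sym (opposite c∉ c∈X a₀∈M a₀∈X b∈ b∉X)

    sign-A : ∀ {c a} → c ∉ M → c ∈ X → a ∈ M → a ∈ X → arc T a c ≡ sign c
    sign-A c∉ c∈X a∈ a∈X = trans (opposite c∉ c∈X a∈ a∈X b₀∈M b₀∉X) (sign-B c∉ c∈X b₀∈M b₀∉X)

    separated : ∀ {c a b} → c ∉ M → c ∈ X → a ∈ M → a ∈ X → b ∈ M → b ∉ X → arc T c a ≢ arc T c b
    separated c∉ c∈X a∈ a∈X b∈ b∉X h =
      clash (trans h (sign-B c∉ c∈X b∈ b∉X)) (flip (∈∉⇒≢ a∈ c∉) (sign-A c∉ c∈X a∈ a∈X))

    rep-∉ : ∀ {x y} → x ∈ X → y ∈ X → y ≢ x → y ∉ rep x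
    rep-∉ x∈ y∈ y≢x h = y≢x (rep-once x∈ y∈ h)

    module _ {a} (a∈M : a ∈ M) (a∈X : a ∈ X) (m : NontrivialModule T (rep a)) where

      -- Such an x would lie in B, as X meets `rep a` once; but c₀ separates it from a while lying
      -- outside the module `rep a`.
      rep-a∩M : ∀ {x} → x ∈ rep a → x ≢ a → x ∉ M
      rep-a∩M {x} x∈ x≢a x∈M with x ∈? X
      ... | yes x∈X = x≢a (rep-once a∈X x∈X x∈)
      ... | no x∉X = separated c₀∉M c₀∈X a∈M a∈X x∈M x∉X
        (uniform m (∈rep a∈X) x∈ (rep-∉ a∈X c₀∈X (∈∉⇒≢ a∈M c₀∉M ∘ sym)))

      -- One vertex d decides all these arcs: x cannot tell a from d, and d, lying in D, cannot tell
      -- x from a.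
      toward-a : ∀ {d} → d ∈ rep a → d ≢ a → ∀ {x} → x ∈ M → x ≢ a → arc T x a ≡ arc T a d
      toward-a d∈ d≢a {x} x∈ x≢a =
        trans (uniform m (∈rep a∈X) d∈ (λ h → rep-a∩M h x≢a x∈))
          (uniform-D′ (rep-a∩M d∈ d≢a) (λ h → d≢a (rep-once a∈X h d∈)) x∈ a∈M)

      ∃toward-a : ∃[ s ] (∀ {x} → x ∈ M → x ≢ a → arc T x a ≡ s)
      ∃toward-a with other T m a
      ... | d , d∈ , d≢a = arc T a d , toward-a d∈ d≢a

    -- By `disjoint-comodules-uniform`, `rep x` is a module once it has a second vertex w. So a
    -- non-module `rep` with two vertices forces all the others to be modules.
    disjoint-∁ : ∀ {x y w} → x ∈ X → y ∈ X → x ≢ y → w ∈ rep x → w ≢ x →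
      ¬ NontrivialModule T (rep x) → ¬ NontrivialModule T (rep y) → ⊥
    disjoint-∁ x∈ y∈ x≢y w∈ w≢x ¬mx ¬my with mc-cases T (rep-mc x∈) | mc-cases T (rep-mc y∈)
    ... | inj₁ mx | _ = ¬mx mx
    ... | _ | inj₁ my = ¬my my
    ... | inj₂ cx | inj₂ cy =
      ¬mx (nontrivial (disjoint-comodules-uniform T cx cy (disj x∈ y∈ x≢y)) w∈ (∈rep x∈) w≢x
        (rep-∉ x∈ y∈ (x≢y ∘ sym)))

    module _ {c} (c∉M : c ∉ M) (c∈X : c ∈ X) (m : NontrivialModule T (rep c)) where

      -- Otherwise a second vertex e of `rep c` lies in D. Now a₀ cannot tell c from e, e cannot
      -- tell a₀ from b₀, and b₀ cannot tell e from c, so c would not separate a₀ from b₀.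
      ∃rep-c∩B : ∃[ b ] b ∈ M × b ∉ X × b ∈ rep c
      ∃rep-c∩B with any? (λ b → (b ∈? M) ×-dec ¬? (b ∈? X) ×-dec (b ∈? rep c))
      ... | yes h = h
      ... | no none with other T m c
      ... | e , e∈ , e≢c = ⊥-elim (clash
        (sym (uniform m (∈rep c∈X) e∈ (rep-∉ c∈X a₀∈X (∈∉⇒≢ a₀∈M c∉M))))
        (trans (uniform-D′ e∉M e∉X a₀∈M b₀∈M)
          (trans (uniform m e∈ (∈rep c∈X) (λ h → none (b₀ , b₀∈M , b₀∉X , h)))
            (flip (∈∉⇒≢ b₀∈M c∉M ∘ sym) (sign-B c∉M c∈X b₀∈M b₀∉X)))))
        where
        e∉X : e ∉ X
        e∉X h = e≢c (rep-once c∈X h e∈)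
        e∉M : e ∉ M
        e∉M h = none (e , h , e∉X , e∈)

    module _ {c} (c∉M : c ∉ M) (c∈X : c ∈ X) (¬m : ¬ NontrivialModule T (rep c)) where

      private
        co : NontrivialModule T (∁ (rep c))
        co = [ (λ m → ⊥-elim (¬m m)) , (λ h → h) ]′ (mc-cases T (rep-mc c∈X))

      -- The module `∁ (rep c)` contains a₀, so it contains no vertex that c separates from a₀.
      B⊆rep-c : ∀ {b} → b ∈ M → b ∉ X → b ∈ rep c
      B⊆rep-c {b} b∈ b∉X = decidable-stable (b ∈? rep c) λ b∉ →
        separated c∉M c∈X a₀∈M a₀∈X b∈ b∉X
          (uniform co (x∉p⇒x∈∁p (rep-∉ c∈X a₀∈X (∈∉⇒≢ a₀∈M c∉M))) (x∉p⇒x∈∁p b∉) (x∈p⇒x∉∁p (∈rep c∈X)))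

      only-module : ∀ {x} → x ∈ X → x ≢ c → NontrivialModule T (rep x)
      only-module {x} x∈ x≢c = decidable-stable (nontrivial? T (rep x)) λ ¬mx →
        disjoint-∁ c∈X x∈ (x≢c ∘ sym) (B⊆rep-c b₀∈M b₀∉X) (∈∉⇒≢ b₀∈M c∉M) ¬m ¬mx

      -- A further `rep c′` would be a module and contain a vertex of B, but all of B lies in
      -- `rep c`.
      only-c : ∀ {c′} → c′ ∉ M → c′ ∈ X → c′ ≡ c
      only-c {c′} c′∉M c′∈X = decidable-stable (c′ ≟ᶠ c) λ c′≢c →
        let b , b∈ , b∉X , b∈rep = ∃rep-c∩B c′∉M c′∈X (only-module c′∈X c′≢c)
        in disj c′∈X c∈X c′≢c b∈rep (B⊆rep-c b∈ b∉X)

      -- Both reps would be modules, each of a, a₀ having one sign from the rest of M. As b₀ lies in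
      -- `rep c`, it sees a and a₀ alike, so the two signs agree; the arc between a and a₀
      -- contradicts this.
      only-a : ∀ {a} → a ∈ M → a ∈ X → a ≡ a₀
      only-a {a} a∈ a∈X = decidable-stable (a ≟ᶠ a₀) λ a≢a₀ →
        let s , to-a = ∃toward-a a∈ a∈X (only-module a∈X (∈∉⇒≢ a∈ c∉M))
            s₀ , to-a₀ = ∃toward-a a₀∈M a₀∈X (only-module a₀∈X (∈∉⇒≢ a₀∈M c∉M))
            s≡s₀ = trans (sym (to-a b₀∈M (∈∉⇒≢ a∈X b₀∉X ∘ sym)))
              (trans (uniform co (x∉p⇒x∈∁p (rep-∉ c∈X a∈X (∈∉⇒≢ a∈ c∉M)))
                  (x∉p⇒x∈∁p (rep-∉ c∈X a₀∈X (∈∉⇒≢ a₀∈M c∉M))) (x∈p⇒x∉∁p (B⊆rep-c b₀∈M b₀∉X)))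
                (to-a₀ b₀∈M (∈∉⇒≢ a₀∈X b₀∉X ∘ sym)))
        in clash (trans (to-a₀ a∈ a≢a₀) (sym s≡s₀)) (flip (a≢a₀ ∘ sym) (to-a a₀∈M (a≢a₀ ∘ sym)))

    -- With two vertices, B would be a nontrivial module of T that misses X.
    only-b : ∀ {t} → (∀ {b} → b ∈ M → b ∉ X → arc T a₀ b ≡ t) → (∀ {a} → a ∈ M → a ∈ X → a ≡ a₀) →
      ∀ {b} → b ∈ M → b ∉ X → b ≡ b₀
    only-b a₀→B A b∈ b∉X = decidable-stable (_ ≟ᶠ b₀) λ b≢b₀ →
      let w , w∈X , w∈B = meets-module (nontrivial B-uniform (in-B b∈ b∉X) (in-B b₀∈M b₀∉X) b≢b₀ (c₀∉M ∘ proj₁ ∘ ∈─⁻))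
      in proj₂ (∈─⁻ w∈B) w∈X
      where
      in-B : ∀ {x} → x ∈ M → x ∉ X → x ∈ M ─ X
      in-B = x∈p∧x∉q⇒x∈p─q

      B-uniform : Uniform T (M ─ X)
      B-uniform {v = v} x∈ y∈ v∉ with v ∈? M | ∈─⁻ x∈ | ∈─⁻ y∈
      ... | no v∉M | xM , x∉X | yM , y∉X = uniform-B v∉M xM x∉X yM y∉X
      ... | yes v∈M | xM , x∉X | yM , y∉X
        with refl ← A v∈M (decidable-stable (v ∈? X) (v∉ ∘ in-B v∈M)) =
        trans (a₀→B xM x∉X) (sym (a₀→B yM y∉X))

    module _ {a} (a∈M : a ∈ M) (a∈X : a ∈ X) (¬m : ¬ NontrivialModule T (rep a)) where

      private
        co : NontrivialModule T (∁ (rep a))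
        co = [ (λ m → ⊥-elim (¬m m)) , (λ h → h) ]′ (mc-cases T (rep-mc a∈X))

        c∉rep : ∀ {c} → c ∉ M → c ∈ X → c ∉ rep a
        c∉rep c∉M c∈X = rep-∉ a∈X c∈X (∈∉⇒≢ a∈M c∉M ∘ sym)

        beyond : ∀ {x} → x ∉ rep a → arc T a x ≡ arc T a c₀
        beyond x∉ = uniform co (x∉p⇒x∈∁p x∉) (x∉p⇒x∈∁p (c∉rep c₀∉M c₀∈X)) (x∈p⇒x∉∁p (∈rep a∈X))

      away-a : ∀ {x} → x ∉ rep a → arc T a x ≡ sign c₀
      away-a x∉ = trans (beyond x∉) (sign-A c₀∉M c₀∈X a∈M a∈X)

      sign-const : ∀ {c} → c ∉ M → c ∈ X → sign c ≡ sign c₀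
      sign-const c∉M c∈X = trans (sym (sign-A c∉M c∈X a∈M a∈X)) (away-a (c∉rep c∉M c∈X))

      -- Suppose that B lies in `rep a`. A vertex of D outside `rep a` is related to a and to b₀ as
      -- c₀ is, but c₀ separates them and D does not. So everything outside `rep a` lies in X and
      -- `rep c₀` is {c₀}, which again makes c₀ see a and b₀ alike.
      ∃B∖rep : ∃[ b ] b ∈ M × b ∉ X × b ∉ rep a
      ∃B∖rep with any? (λ b → (b ∈? M) ×-dec ¬? (b ∈? X) ×-dec ¬? (b ∈? rep a))
      ... | yes h = h
      ... | no none = ⊥-elim (by-cases (mc-cases T (rep-mc c₀∈X)))
        where
        outside-X : ∀ {x} → x ∉ rep a → x ∈ X
        outside-X {x} x∉ = decidable-stable (x ∈? X) λ x∉X → clash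
          (beyond x∉)
          (trans
            (uniform-D′ (λ x∈M → none (x , x∈M , x∉X , x∉)) x∉X a∈M b₀∈M)
            (trans
              (uniform co (x∉p⇒x∈∁p x∉) (x∉p⇒x∈∁p (c∉rep c₀∉M c₀∈X)) (x∈p⇒x∉∁p b₀∈rep))
              (flip (∈∉⇒≢ b₀∈M c₀∉M ∘ sym)
                (trans (sign-B c₀∉M c₀∈X b₀∈M b₀∉X) (sym (sign-A c₀∉M c₀∈X a∈M a∈X))))))
          where
          b₀∈rep : b₀ ∈ rep a
          b₀∈rep = decidable-stable (b₀ ∈? rep a) λ h → none (b₀ , b₀∈M , b₀∉X , h)

        rep-c₀⊆ : ∀ {x} → x ∈ rep c₀ → x ≡ c₀
        rep-c₀⊆ x∈ = rep-once c₀∈X (outside-X (disj c₀∈X a∈X (∈∉⇒≢ a∈M c₀∉M ∘ sym) x∈)) x∈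

        by-cases : NontrivialModule T (rep c₀) ⊎ NontrivialModule T (∁ (rep c₀)) → ⊥
        by-cases (inj₁ m) = let d , d∈ , d≢c₀ = other T m c₀ in d≢c₀ (rep-c₀⊆ d∈)
        by-cases (inj₂ c) = separated c₀∉M c₀∈X a∈M a∈X b₀∈M b₀∉X
          (uniform c (∉rep (∈∉⇒≢ a∈M c₀∉M)) (∉rep (∈∉⇒≢ b₀∈M c₀∉M)) (x∈p⇒x∉∁p (∈rep c₀∈X)))
          where
          ∉rep : ∀ {x} → x ≢ c₀ → x ∈ ∁ (rep c₀)
          ∉rep x≢ = x∉p⇒x∈∁p (x≢ ∘ rep-c₀⊆)

      -- The complement K of D ∩ `rep a` would be a module containing X: a vertex outside K sees M
      -- uniformly and `∁ (rep a)` uniformly, and b lies in both.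
      D∩rep : ∀ {x} → x ∉ M → x ∉ X → x ∉ rep a
      D∩rep {x} x∉M x∉X x∈rep = in-K x x∈K
        where
        K? : ∀ y → Dec (¬ (y ∉ M × y ∉ X × y ∈ rep a))
        K? y = ¬? (¬? (y ∈? M) ×-dec ¬? (y ∈? X) ×-dec (y ∈? rep a))

        K = sub K?
        b = proj₁ ∃B∖rep
        b∈M = proj₁ (proj₂ ∃B∖rep)
        b∉rep = proj₂ (proj₂ (proj₂ ∃B∖rep))

        ∉K⁻ : ∀ {v} → v ∉ K → v ∉ M × v ∉ X × v ∈ rep a
        ∉K⁻ {v} v∉ = decidable-stable (¬? (v ∈? M) ×-dec ¬? (v ∈? X) ×-dec (v ∈? rep a)) (v∉ ∘ ∈sub⁺ K?)

        to-b : ∀ {y v} → y ∈ K → v ∉ K → arc T v y ≡ arc T v b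
        to-b {y} y∈ v∉ with y ∈? M | ∉K⁻ v∉
        ... | yes y∈M | v∉M , v∉X , _ = uniform-D v∉M v∉X y∈M b∈M
        ... | no y∉M | _ , _ , v∈rep = uniform co (x∉p⇒x∈∁p y∉rep) (x∉p⇒x∈∁p b∉rep) (x∈p⇒x∉∁p v∈rep)
          where
          y∉rep : y ∉ rep a
          y∉rep h with y ∈? X
          ... | yes y∈X = c∉rep y∉M y∈X h
          ... | no y∉X = ∈sub⁻ K? y∈ (y∉M , y∉X , h)

        in-K : ∀ w → ¬ ¬ (w ∈ K)
        in-K w w∉K =
          let u , u∈X , u∉K = meets-outside (nontrivial (λ p q v → trans (to-b p v) (sym (to-b q v)))
                (∈sub⁺ K? (λ h → proj₁ h b∈M)) (∈sub⁺ K? (λ h → proj₁ h a∈M)) (∈∉⇒≢ (∈rep a∈X) b∉rep ∘ sym) w∉K)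
          in proj₁ (proj₂ (∉K⁻ u∉K)) u∈X

        x∈K : x ∉ K
        x∈K h = ∈sub⁻ K? h (x∉M , x∉X , x∈rep)

      rep-a⊆ : ∀ {x} → x ∈ rep a → x ≢ a → x ∈ M × x ∉ X
      rep-a⊆ {x} x∈ x≢a = decidable-stable (x ∈? M) (λ x∉M → D∩rep x∉M x∉X x∈) , x∉X
        where
        x∉X : x ∉ X
        x∉X h = x≢a (rep-once a∈X h x∈)

    -- Without such a b, the vertex a is a source or a sink of T (`is-extreme`); with one, `rep a`
    -- has a second vertex, which then lies in B.
    BackArc : Fin n → Set
    BackArc a = ∃[ b ] b ∈ rep a × b ≢ a × arc T b a ≡ sign c₀

    back-arc? : ∀ a → Dec (BackArc a)
    back-arc? a = any? λ b → (b ∈? rep a) ×-dec ¬? (b ≟ᶠ a) ×-dec (arc T b a ≟ sign c₀)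

    module _ {a} (a∈M : a ∈ M) (a∈X : a ∈ X) (¬m : ¬ NontrivialModule T (rep a))
      (none : ¬ BackArc a) where

      is-extreme : ∀ {x} → x ≢ a → arc T a x ≡ sign c₀
      is-extreme {x} x≢a with x ∈? rep a
      ... | no x∉ = away-a a∈M a∈X ¬m x∉
      ... | yes x∈ = arc-flip′ T x≢a (¬-not λ h → none (x , x∈ , x≢a , h))

    TheObstruction : Set
    TheObstruction = (∀ {x} → x ∈ X → x ≡ a₀ ⊎ x ≡ c₀) × Obstruction T (rep a₀) (rep c₀) a₀ c₀

    shape : (∀ {a} → a ∈ M → a ∈ X → a ≡ a₀) → (∀ {c} → c ∉ M → c ∈ X → c ≡ c₀) → ∀ {x} → x ∈ X → x ≡ a₀ ⊎ x ≡ c₀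
    shape A C {x} x∈X with x ∈? M
    ... | yes x∈M = inj₁ (A x∈M x∈X)
    ... | no x∉M = inj₂ (C x∉M x∈X)

    obstruction-outer-c : ¬ NontrivialModule T (rep c₀) → TheObstruction
    obstruction-outer-c ¬m = shape A (only-c c₀∉M c₀∈X ¬m) ,
      outer-c b₀ ¬m m (B⊆rep-c c₀∉M c₀∈X ¬m b₀∈M b₀∉X) (∈∉⇒≢ b₀∈M c₀∉M)
        (λ d∈ d≢a₀ → toward-a a₀∈M a₀∈X m d∈ d≢a₀ b₀∈M (∈∉⇒≢ a₀∈X b₀∉X ∘ sym))
        (λ v≢a₀ v≢b₀ v≢c₀ → let v∉M , v∉X = in-D v≢a₀ v≢b₀ v≢c₀ in uniform-D v∉M v∉X a₀∈M b₀∈M)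
        (separated c₀∉M c₀∈X a₀∈M a₀∈X b₀∈M b₀∉X)
      where
      A : ∀ {a} → a ∈ M → a ∈ X → a ≡ a₀
      A = only-a c₀∉M c₀∈X ¬m

      m : NontrivialModule T (rep a₀)
      m = only-module c₀∉M c₀∈X ¬m a₀∈X a₀≢c₀

      B : ∀ {b} → b ∈ M → b ∉ X → b ≡ b₀
      B = only-b (λ b∈ b∉X → flip (∈∉⇒≢ a₀∈X b∉X ∘ sym)
        (proj₂ (∃toward-a a₀∈M a₀∈X m) b∈ (∈∉⇒≢ a₀∈X b∉X ∘ sym))) A

      in-D : ∀ {v} → v ≢ a₀ → v ≢ b₀ → v ≢ c₀ → v ∉ M × v ∉ X
      in-D {v} v≢a₀ v≢b₀ v≢c₀ = v∉M , v∉X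
        where
        v∉X : v ∉ X
        v∉X v∈X = [ v≢a₀ , v≢c₀ ]′ (shape A (only-c c₀∉M c₀∈X ¬m) v∈X)
        v∉M : v ∉ M
        v∉M v∈M = v≢b₀ (B v∈M v∉X)

    module _ (m : NontrivialModule T (rep c₀)) where

      C-module : ∀ {c} → c ∉ M → c ∈ X → NontrivialModule T (rep c)
      C-module {c} c∉M c∈X = decidable-stable (nontrivial? T (rep c)) λ ¬m →
        ¬m (subst (NontrivialModule T ∘ rep) (only-c c∉M c∈X ¬m c₀∉M c₀∈X) m)

      c→b : ∀ {c} (c∉M : c ∉ M) (c∈X : c ∈ X) {c′} → c′ ∉ M → c′ ∈ X → c′ ≢ c → arc T c′ c ≡ sign c′
      c→b c∉M c∈X c′∉M c′∈X c′≢c with ∃rep-c∩B c∉M c∈X (C-module c∉M c∈X)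
      ... | b , b∈M , b∉X , b∈rep =
        trans (uniform (C-module c∉M c∈X) (∈rep c∈X) b∈rep (rep-∉ c∈X c′∈X c′≢c)) (sign-B c′∉M c′∈X b∈M b∉X)

      a→b : ∀ {c} (c∉M : c ∉ M) (c∈X : c ∈ X) {a} → a ∈ M → a ∈ X → ∃[ b ] b ∈ M × b ∉ X × arc T a b ≡ sign c
      a→b c∉M c∈X a∈M a∈X with ∃rep-c∩B c∉M c∈X (C-module c∉M c∈X)
      ... | b , b∈M , b∉X , b∈rep = b , b∈M , b∉X ,
        trans (uniform (C-module c∉M c∈X) b∈rep (∈rep c∈X) (rep-∉ c∈X a∈X (∈∉⇒≢ a∈M c∉M))) (sign-A c∉M c∈X a∈M a∈X)

      to-a-sign : ∀ {c} (c∉M : c ∉ M) (c∈X : c ∈ X) {a} (a∈M : a ∈ M) (a∈X : a ∈ X) (ma : NontrivialModule T (rep a)) →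
        sign c ≡ not (proj₁ (∃toward-a a∈M a∈X ma))
      to-a-sign c∉M c∈X a∈M a∈X ma with a→b c∉M c∈X a∈M a∈X
      ... | b , b∈M , b∉X , ab = trans (sym ab)
        (flip (∈∉⇒≢ a∈X b∉X ∘ sym) (proj₂ (∃toward-a a∈M a∈X ma) b∈M (∈∉⇒≢ a∈X b∉X ∘ sym)))

      sign-c : ∀ {c} → c ∉ M → c ∈ X → sign c ≡ sign c₀
      sign-c c∉M c∈X with nontrivial? T (rep a₀)
      ... | yes ma = trans (to-a-sign c∉M c∈X a₀∈M a₀∈X ma) (sym (to-a-sign c₀∉M c₀∈X a₀∈M a₀∈X ma))
      ... | no ¬ma = sign-const a₀∈M a₀∈X ¬ma c∉M c∈X

      -- By `c→b`, both directions between two vertices of C would carry the common sign.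
      C : ∀ {c} → c ∉ M → c ∈ X → c ≡ c₀
      C {c} c∉M c∈X = decidable-stable (c ≟ᶠ c₀) λ c≢c₀ → clash
        (trans (c→b c∉M c∈X c₀∉M c₀∈X (c≢c₀ ∘ sym)) (sym (sign-c c∉M c∈X)))
        (flip c≢c₀ (c→b c₀∉M c₀∈X c∉M c∈X c≢c₀))

      -- If `rep a` is a module, all arcs from a into M have one sign, known from an arc into
      -- `rep c₀` ∩ B. If not, a′ and c₀ lie together in the module `∁ (rep a)`.
      a→a : ∀ {a} (a∈M : a ∈ M) (a∈X : a ∈ X) {a′} → a′ ∈ M → a′ ∈ X → a′ ≢ a → arc T a a′ ≡ sign c₀
      a→a {a} a∈M a∈X a′∈M a′∈X a′≢a with nontrivial? T (rep a)
      ... | yes ma = trans (flip a′≢a (proj₂ (∃toward-a a∈M a∈X ma) a′∈M a′≢a)) (sym (to-a-sign c₀∉M c₀∈X a∈M a∈X ma))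
      ... | no ¬ma = away-a a∈M a∈X ¬ma (rep-∉ a∈X a′∈X a′≢a)

      A : ∀ {a} → a ∈ M → a ∈ X → a ≡ a₀
      A {a} a∈M a∈X = decidable-stable (a ≟ᶠ a₀) λ a≢a₀ → clash
        (a→a a∈M a∈X a₀∈M a₀∈X (a≢a₀ ∘ sym)) (flip (a≢a₀ ∘ sym) (a→a a₀∈M a₀∈X a∈M a∈X a≢a₀))

      private
        X⊆ : ∀ {x} → x ∈ X → x ≡ a₀ ⊎ x ≡ c₀
        X⊆ = shape A C

        b₁ = proj₁ (∃rep-c∩B c₀∉M c₀∈X m)
        b₁∈M = proj₁ (proj₂ (∃rep-c∩B c₀∉M c₀∈X m))
        b₁∉X = proj₁ (proj₂ (proj₂ (∃rep-c∩B c₀∉M c₀∈X m)))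
        b₁∈rep = proj₂ (proj₂ (proj₂ (∃rep-c∩B c₀∉M c₀∈X m)))

      module _ (a₀→B : ∀ {b} → b ∈ M → b ∉ X → arc T a₀ b ≡ sign c₀) where

        B : ∀ {b} → b ∈ M → b ∉ X → b ≡ b₁
        B b∈ b∉X = trans (only-b a₀→B A b∈ b∉X) (sym (only-b a₀→B A b₁∈M b₁∉X))

        in-D : ∀ {v} → v ≢ a₀ → v ≢ b₁ → v ≢ c₀ → v ∉ M × v ∉ X
        in-D {v} v≢a₀ v≢b v≢c₀ = (λ v∈M → v≢b (B v∈M v∉X)) , v∉X
          where
          v∉X : v ∉ X
          v∉X v∈X = [ v≢a₀ , v≢c₀ ]′ (X⊆ v∈X)

        private
          K = ⁅ a₀ ⁆ ∪ rep c₀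

          a₀∈K : a₀ ∈ K
          a₀∈K = x∈p∪q⁺ (inj₁ (x∈⁅x⁆ a₀))

          c₀∈K : c₀ ∈ K
          c₀∈K = x∈p∪q⁺ (inj₂ (∈rep c₀∈X))

          K-uniform : Uniform T K
          K-uniform {v = v} x∈ y∈ v∉ = trans (to-b x∈) (sym (to-b y∈))
            where
            D = in-D (∈∉⇒≢ a₀∈K v∉ ∘ sym) (∈∉⇒≢ (x∈p∪q⁺ (inj₂ b₁∈rep)) v∉ ∘ sym) (∈∉⇒≢ c₀∈K v∉ ∘ sym)

            to-b : ∀ {x} → x ∈ K → arc T v x ≡ arc T v b₁
            to-b x∈ with x∈p∪q⁻ ⁅ a₀ ⁆ (rep c₀) x∈
            ... | inj₂ x∈rep = uniform m x∈rep b₁∈rep (proj₂ (∉∪⁻ v∉))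
            ... | inj₁ x∈a with refl ← x∈⁅y⁆⇒x≡y a₀ x∈a = uniform-D (proj₁ D) (proj₂ D) a₀∈M b₁∈M

        -- K is a module: as B is {b₁}, a vertex outside K lies in D and does not tell a₀ from b₁,
        -- which belongs to `rep c₀`. Since K contains X, it is the whole vertex set.
        rest-in-rep : ∀ {x} → x ≢ a₀ → x ∈ rep c₀
        rest-in-rep {x} x≢a₀ = decidable-stable (x ∈? rep c₀) λ x∉rep →
          let u , u∈X , u∉K = meets-outside (nontrivial K-uniform a₀∈K c₀∈K a₀≢c₀ λ h →
                [ (λ x∈a → x≢a₀ (x∈⁅y⁆⇒x≡y a₀ x∈a)) , x∉rep ]′ (x∈p∪q⁻ ⁅ a₀ ⁆ (rep c₀) h))
          in [ ∈∉⇒≢ a₀∈K u∉K ∘ sym , ∈∉⇒≢ c₀∈K u∉K ∘ sym ]′ (X⊆ u∈X)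

      module-a₀-impossible : ¬ NontrivialModule T (rep a₀)
      module-a₀-impossible ma = disj a₀∈X c₀∈X a₀≢c₀ d∈ (rest-in-rep a₀→B d≢a₀)
        where
        d = proj₁ (other T ma a₀)
        d∈ = proj₁ (proj₂ (other T ma a₀))
        d≢a₀ = proj₂ (proj₂ (other T ma a₀))

        a₀→B : ∀ {b} → b ∈ M → b ∉ X → arc T a₀ b ≡ sign c₀
        a₀→B b∈ b∉X = trans (flip (∈∉⇒≢ a₀∈X b∉X ∘ sym) (proj₂ (∃toward-a a₀∈M a₀∈X ma) b∈ (∈∉⇒≢ a₀∈X b∉X ∘ sym)))
          (sym (to-a-sign c₀∉M c₀∈X a₀∈M a₀∈X ma))

      obstruction-extreme : ¬ NontrivialModule T (rep a₀) →
        ¬ BackArc a₀ → TheObstruction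
      obstruction-extreme ¬ma none = X⊆ ,
        extreme (sign c₀) b₁ is-ext (rest-in-rep a₀→B) m (sign-B c₀∉M c₀∈X b₁∈M b₁∉X)
          (∈∉⇒≢ a₀∈X b₁∉X ∘ sym) (∈∉⇒≢ b₁∈M c₀∉M)
          (λ x≢a₀ x≢b x≢c₀ → let x∉M , x∉X = in-D a₀→B x≢a₀ x≢b x≢c₀ in
            trans (uniform-D′ x∉M x∉X b₁∈M a₀∈M) (is-ext x≢a₀))
        where
        is-ext : ∀ {x} → x ≢ a₀ → arc T a₀ x ≡ sign c₀
        is-ext = is-extreme a₀∈M a₀∈X ¬ma none

        a₀→B : ∀ {b} → b ∈ M → b ∉ X → arc T a₀ b ≡ sign c₀
        a₀→B b∈ b∉X = is-ext (∈∉⇒≢ a₀∈X b∉X ∘ sym)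

      obstruction-outer-a : ¬ NontrivialModule T (rep a₀) →
        BackArc a₀ → TheObstruction
      obstruction-outer-a ¬ma (e , e∈rep , e≢a₀ , ea) = X⊆ ,
        outer-a (sign c₀) b₁ ¬ma m b₁∈rep (∈∉⇒≢ b₁∈M c₀∉M) outside refl (sign-B c₀∉M c₀∈X b₁∈M b₁∉X)
          (λ v∈ v≢a₀ → let v∈M , v∉X = rep-a⊆ a₀∈M a₀∈X ¬ma v∈ v≢a₀ in
            flip (∈∉⇒≢ v∈M c₀∉M ∘ sym) (sign-B c₀∉M c₀∈X v∈M v∉X))
        where
        co : NontrivialModule T (∁ (rep a₀))
        co = [ (λ m → ⊥-elim (¬ma m)) , (λ h → h) ]′ (mc-cases T (rep-mc a₀∈X))

        c₀∉rep : c₀ ∉ rep a₀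
        c₀∉rep = rep-∉ a₀∈X c₀∈X (a₀≢c₀ ∘ sym)

        e∈M = proj₁ (rep-a⊆ a₀∈M a₀∈X ¬ma e∈rep e≢a₀)
        e∉X = proj₂ (rep-a⊆ a₀∈M a₀∈X ¬ma e∈rep e≢a₀)

        -- For x in D, the arc from e to x has `sign c₀` because x sees e and a₀ alike; the arc from
        -- x to e has it too, because x and c₀ lie in the module `∁ (rep a₀)`.
        in-M∪X : ∀ {x} → x ∉ rep a₀ → x ∉ X → x ∈ M
        in-M∪X {x} x∉rep x∉X = decidable-stable (x ∈? M) λ x∉M → clash
          (trans (uniform-D′ x∉M x∉X e∈M a₀∈M) (away-a a₀∈M a₀∈X ¬ma x∉rep))
          (flip (∈∉⇒≢ e∈M x∉M ∘ sym)
            (trans (uniform-flip′ x∉rep) (sign-B c₀∉M c₀∈X e∈M e∉X)))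
          where
          uniform-flip′ : x ∉ rep a₀ → arc T x e ≡ arc T c₀ e
          uniform-flip′ h = uniform-flip T (uniform co) (x∉p⇒x∈∁p h) (x∉p⇒x∈∁p c₀∉rep) (x∈p⇒x∉∁p e∈rep)

        -- By `in-M∪X` these are all the vertices outside both X and `rep a₀`. They would form a
        -- nontrivial module missing X if b₁ were not the only one.
        B₂ = M ─ (X ∪ rep a₀)

        in-B₂ : ∀ {x} → x ∈ M → x ∉ X → x ∉ rep a₀ → x ∈ B₂
        in-B₂ x∈ x∉X x∉rep = x∈p∧x∉q⇒x∈p─q x∈ ([ x∉X , x∉rep ]′ ∘ x∈p∪q⁻ X (rep a₀))

        B₂⁻ : ∀ {x} → x ∈ B₂ → x ∈ M × x ∉ X × x ∉ rep a₀
        B₂⁻ x∈ = let x∈M , x∉ = ∈─⁻ x∈ in x∈M , ∉∪⁻ x∉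

        B₂-uniform : Uniform T B₂
        B₂-uniform {v = v} x∈ y∈ v∉ with v ∈? rep a₀ | v ∈? X | B₂⁻ x∈ | B₂⁻ y∈
        ... | yes v∈rep | _ | _ , _ , x∉ | _ , _ , y∉ = uniform co (x∉p⇒x∈∁p x∉) (x∉p⇒x∈∁p y∉) (x∈p⇒x∉∁p v∈rep)
        ... | no v∉rep | no v∉X | _ | _ = ⊥-elim (v∉ (in-B₂ (in-M∪X v∉rep v∉X) v∉X v∉rep))
        ... | no v∉rep | yes v∈X | xM , x∉X , _ | yM , y∉X , _ =
          uniform-B (λ v∈M → v∉rep (subst (_∈ rep a₀) (sym (A v∈M v∈X)) (∈rep a₀∈X))) xM x∉X yM y∉X

        outside : ∀ {x} → x ∉ rep a₀ → x ≡ c₀ ⊎ x ≡ b₁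
        outside {x} x∉rep with x ∈? X
        ... | yes x∈X = inj₂⇒ (X⊆ x∈X)
          where
          inj₂⇒ : x ≡ a₀ ⊎ x ≡ c₀ → x ≡ c₀ ⊎ x ≡ b₁
          inj₂⇒ (inj₁ refl) = ⊥-elim (x∉rep (∈rep a₀∈X))
          inj₂⇒ (inj₂ h) = inj₁ h
        ... | no x∉X = inj₂ (decidable-stable (x ≟ᶠ b₁) λ x≢b →
          let w , w∈X , w∈ = meets-module (nontrivial B₂-uniform (in-B₂ (in-M∪X x∉rep x∉X) x∉X x∉rep)
                (in-B₂ b₁∈M b₁∉X (λ h → disj a₀∈X c₀∈X a₀≢c₀ h b₁∈rep)) x≢b (c₀∉M ∘ proj₁ ∘ B₂⁻))
          in proj₁ (proj₂ (B₂⁻ w∈)) w∈X)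

    obstruction-at : TheObstruction
    obstruction-at with nontrivial? T (rep c₀)
    ... | no ¬m = obstruction-outer-c ¬m
    ... | yes m with back-arc? a₀
    ... | yes back = obstruction-outer-a m (module-a₀-impossible m) back
    ... | no none = obstruction-extreme m (module-a₀-impossible m) none

  obstruction : ∃[ a ] ∃[ c ] a ∈ X × c ∈ X × a ≢ c × (∀ {x} → x ∈ X → x ≡ a ⊎ x ≡ c) ×
    Obstruction T (rep a) (rep c) a c
  obstruction with ∃A | ∃B | ∃C
  ... | a , a∈M , a∈X | b , b∈M , b∉X | c , c∉M , c∈X =
    a , c , a∈X , c∈X , ∈∉⇒≢ a∈M c∉M , At.obstruction-at a∈M a∈X b∈M b∉X c∉M c∈X

-- Moving one vertex of a two-element transversal

module _ {n : ℕ} (T : Tournament n) where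

  open Valid

  Isolated : Subset n → Set
  Isolated N = ∀ {K w} → mc T K → w ∈ K → w ∈ N → K ≡ N

  -- As `rep c` meets no other minimal co-module, e lies in the same minimal co-modules as c. So
  -- only `covers` has to be supplied anew.
  module Exchange {X : Subset n} (V : Valid T X) {a c : Fin n} (a∈X : a ∈ X) (c∈X : c ∈ X) (a≢c : a ≢ c)
    (X⊆ : ∀ {x} → x ∈ X → x ≡ a ⊎ x ≡ c) (isolated : Isolated (rep V c))
    {e : Fin n} (e∈ : e ∈ rep V c) (covers′ : ∀ {M} → NontrivialModule T M → ∃[ y ] y ∈ M × y ∉ pair a e) where

    rep′ : Fin n → Subset n
    rep′ x = if does (x ≟ᶠ a) then rep V a else rep V c

    rep′-a : rep′ a ≡ rep V a
    rep′-a with a ≟ᶠ a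
    ... | yes _ = refl
    ... | no a≢a = ⊥-elim (a≢a refl)

    e≢a : e ≢ a
    e≢a = ∈∉⇒≢ e∈ λ a∈ → a≢c (rep-once V c∈X a∈X a∈)

    rep′-e : rep′ e ≡ rep V c
    rep′-e with e ≟ᶠ a
    ... | yes e≡a = ⊥-elim (e≢a e≡a)
    ... | no _ = refl

    valid : Valid T (pair a e)
    valid .rep = rep′
    valid .rep-mc x∈ with ∈²⁻ x∈
    ... | inj₁ refl = subst (mc T) (sym rep′-a) (rep-mc V a∈X)
    ... | inj₂ refl = subst (mc T) (sym rep′-e) (rep-mc V c∈X)
    valid .∈rep x∈ with ∈²⁻ x∈
    ... | inj₁ refl = subst (a ∈_) (sym rep′-a) (∈rep V a∈X)
    ... | inj₂ refl = subst (e ∈_) (sym rep′-e) e∈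
    valid .disj {v = v} x∈ y∈ x≢y v∈ v∈′ with ∈²⁻ x∈ | ∈²⁻ y∈
    ... | inj₁ refl | inj₁ refl = x≢y refl
    ... | inj₂ refl | inj₂ refl = x≢y refl
    ... | inj₁ refl | inj₂ refl = disj V a∈X c∈X a≢c (subst (v ∈_) rep′-a v∈) (subst (v ∈_) rep′-e v∈′)
    ... | inj₂ refl | inj₁ refl = disj V a∈X c∈X a≢c (subst (v ∈_) rep′-a v∈′) (subst (v ∈_) rep′-e v∈)
    valid .meets mcN with meets V mcN
    ... | x , x∈X , x∈N with X⊆ x∈X
    ... | inj₁ refl = a , ∈²ˡ , x∈N
    ... | inj₂ refl = e , ∈²ʳ , subst (e ∈_) (sym (isolated mcN x∈N (∈rep V c∈X))) e∈
    valid .once mcN x∈ y∈ x∈N y∈N with ∈²⁻ x∈ | ∈²⁻ y∈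
    ... | inj₁ refl | inj₁ refl = refl
    ... | inj₂ refl | inj₂ refl = refl
    ... | inj₁ refl | inj₂ refl = ⊥-elim (a∉c mcN x∈N y∈N)
      where
      a∉c : ∀ {N} → mc T N → a ∈ N → e ∉ N
      a∉c mcN a∈N e∈N = a≢c (rep-once V c∈X a∈X (subst (a ∈_) (isolated mcN e∈N e∈) a∈N))
    ... | inj₂ refl | inj₁ refl = ⊥-elim
      (a≢c (rep-once V c∈X a∈X (subst (a ∈_) (isolated mcN x∈N e∈) y∈N)))
    valid .covers = covers′

    -- Either of a, e may be the vertex inside the surviving module, hence the two orders.
    obstructions : ∀ {M} → NontrivialModule (Inv T (pair a e)) M →
      Obstruction T (rep V a) (rep V c) a e ⊎ Obstruction T (rep V c) (rep V a) e a
    obstructions bad with Survivor.obstruction T valid bad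
    ... | x , y , x∈ , y∈ , x≢y , _ , o with ∈²⁻ x∈ | ∈²⁻ y∈
    ... | inj₁ refl | inj₁ refl = ⊥-elim (x≢y refl)
    ... | inj₂ refl | inj₂ refl = ⊥-elim (x≢y refl)
    ... | inj₁ refl | inj₂ refl =
      inj₁ (subst (λ P → Obstruction T P (rep V c) a e) rep′-a (subst (λ N → Obstruction T (rep′ a) N a e) rep′-e o))
    ... | inj₂ refl | inj₁ refl =
      inj₂ (subst (λ P → Obstruction T P (rep V a) e a) rep′-e (subst (λ N → Obstruction T (rep′ e) N e a) rep′-a o))

  survivor? : ∀ X → Dec (∃[ M ] NontrivialModule (Inv T X) M)
  survivor? X = anySubset? (nontrivial? (Inv T X))

  no-survivor⇒indecomposable : ∀ {X} → ¬ (∃[ M ] NontrivialModule (Inv T X) M) → Indecomposable (Inv T X)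
  no-survivor⇒indecomposable {X} none M mod =
    [ (λ t → t) , (λ m → ⊥-elim (none (M , m))) ]′ (trivial⊎nontrivial (Inv T X) mod)

  Good : Set
  Good = ∃[ X ] Valid T X × Indecomposable (Inv T X)

  module _ {X : Subset n} (V : Valid T X) {a c : Fin n} (a∈X : a ∈ X) (c∈X : c ∈ X) (a≢c : a ≢ c)
    (X⊆ : ∀ {x} → x ∈ X → x ≡ a ⊎ x ≡ c) (isolated : Isolated (rep V c))
    (covers′ : ∀ {e M} → e ∈ rep V c → NontrivialModule T M → ∃[ y ] y ∈ M × y ∉ pair a e) where

    exchange :
      ((∀ {e} → e ∈ rep V c → Obstruction T (rep V a) (rep V c) a e ⊎ Obstruction T (rep V c) (rep V a) e a) → ⊥) →
      Good
    exchange contra with any? (λ e → (e ∈? rep V c) ×-dec ¬? (survivor? (pair a e)))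
    ... | yes (e , e∈ , none) = pair a e ,
      Exchange.valid V a∈X c∈X a≢c X⊆ isolated e∈ (covers′ e∈) , no-survivor⇒indecomposable none
    ... | no none = ⊥-elim (contra λ {e} e∈ →
      let M , bad = decidable-stable (survivor? (pair a e)) (λ h → none (e , e∈ , h))
      in Exchange.obstructions V a∈X c∈X a≢c X⊆ isolated e∈ (covers′ e∈) bad)

  isolated⇐nonmodule : ∀ {N} → mc T N → ¬ NontrivialModule T N → Isolated N
  isolated⇐nonmodule {N} mcN ¬m {K} mcK w∈K w∈N = decidable-stable (≡-dec _≟_ K N) λ K≢N →
    ¬m (proj₁ (mc-meeting T mcN mcK (K≢N ∘ sym) w∈N w∈K))

  module _ (5≤n : 5 ≤ n) where

    -- A minimal co-module meeting another one has two vertices, whereas N has at least four.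
    isolated⇐large : ∀ {N a} → mc T N → (∀ {x} → x ≢ a → x ∈ N) → Isolated N
    isolated⇐large {N} {a} mcN big {K} {w} mcK w∈K w∈N = decidable-stable (≡-dec _≟_ K N) λ K≢N →
      let _ , u , _ , _ , small = mc-meeting T mcN mcK (K≢N ∘ sym) w∈N w∈K
          z , z≢a , z≢u , z≢w , _ = fresh 5≤n a u w w
      in [ z≢u , z≢w ]′ (small (big z≢a))

    -- Contradictions when every replacement fails

    module _ {P N : Subset n} {a : Fin n} {s : Bool} (P∩N : ∀ {v} → v ∈ P → v ∉ N)
      (big : ∀ {x} → x ≢ a → x ∈ N) (mN : NontrivialModule T N) (ax : ∀ {x} → x ≢ a → arc T a x ≡ s)
      (obs : ∀ {e} → e ∈ N → Obstruction T P N a e ⊎ Obstruction T N P e a) where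

      private
        in-P : ∀ {x} → x ∈ P → x ≡ a
        in-P {x} x∈ = decidable-stable (x ≟ᶠ a) λ x≢a → P∩N x∈ (big x≢a)

        two-outside : ∀ {u v} → ¬ (∀ {x} → x ∉ P → x ≡ u ⊎ x ≡ v)
        two-outside {u} {v} h =
          let x , x≢a , x≢u , x≢v , _ = fresh 5≤n a u v v
          in [ x≢u , x≢v ]′ (h (x≢a ∘ in-P))

        -- Since P is {a}, only `extreme` with a itself as the extreme vertex can occur. Up to s,
        -- its b would come right after a were it not for the arc from e.
        next : ∀ {e} → e ≢ a → ∃[ b ] arc T e b ≡ s × b ≢ a × b ≢ e ×
          (∀ {x} → x ≢ a → x ≢ b → x ≢ e → arc T b x ≡ s)
        next {e} e≢a with obs (big e≢a)
        ... | inj₁ (extreme s′ b ax′ _ _ eb b≢a b≢e bx) =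
          b , trans eb s′≡s , b≢a , b≢e , λ x≢a x≢b x≢e → trans (bx x≢a x≢b x≢e) s′≡s
          where
          s′≡s : s′ ≡ s
          s′≡s = trans (sym (ax′ e≢a)) (ax e≢a)
        ... | inj₁ (outer-c _ ¬m _ _ _ _ _ _) = ⊥-elim (¬m mN)
        ... | inj₁ (outer-a _ _ _ _ _ _ out _ _ _) = ⊥-elim (two-outside out)
        ... | inj₂ (extreme _ _ _ all _ _ _ _ _) =
          let x , x≢a , x≢e , _ = fresh 5≤n a e e e in ⊥-elim (x≢a (in-P (all x≢e)))
        ... | inj₂ (outer-c _ _ _ b∈ b≢a _ _ _) = ⊥-elim (b≢a (in-P b∈))
        ... | inj₂ (outer-a _ _ ¬m _ _ _ _ _ _ _) = ⊥-elim (¬m mN)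

        -- Away from a, b dominates all but c and b′ dominates all but e (up to the sign s),
        -- so neither of b, b′ could be dominated by the other.
        next-back : ∀ {c b e b′} → c ≢ e → e ≢ a → e ≢ b → b ≢ a → b′ ≢ a →
          arc T e b′ ≡ s →
          (∀ {x} → x ≢ a → x ≢ b → x ≢ c → arc T b x ≡ s) →
          (∀ {x} → x ≢ a → x ≢ b′ → x ≢ e → arc T b′ x ≡ s) → b′ ≡ c
        next-back {c} {b} {e} {b′} c≢e e≢a e≢b b≢a b′≢a eb′ bx b′x = decidable-stable (b′ ≟ᶠ c) λ b′≢c →
          by-cases b′≢c (b ≟ᶠ b′)
          where
          by-cases : b′ ≢ c → Dec (b ≡ b′) → ⊥
          by-cases _ (yes refl) = not-¬ eb′ (arc-flip T (e≢b ∘ sym) (bx e≢a e≢b (c≢e ∘ sym)))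
          by-cases b′≢c (no b≢b′) = not-¬ (b′x b≢a b≢b′ (e≢b ∘ sym))
            (arc-flip T b≢b′ (bx b′≢a (b≢b′ ∘ sym) b′≢c))

      -- The vertices a, b, c, e, f are distinct, which takes n ≥ 5. By `next-back` both e and f
      -- lead to c. Up to s, c as successor of e dominates f, and as successor of f is dominated by
      -- it.
      extreme-impossible : ⊥
      extreme-impossible =
        let c , c≢a , _ = fresh 5≤n a a a a
            b , cb , b≢a , b≢c , bx = next c≢a
            e , e≢a , e≢b , e≢c , _ = fresh 5≤n a b c c
            f , f≢a , f≢b , f≢c , f≢e = fresh 5≤n a b c e
            b₁ , eb₁ , b₁≢a , b₁≢e , b₁x = next e≢a
            b₂ , fb₂ , b₂≢a , b₂≢f , b₂x = next f≢a
            b₁≡c = next-back (e≢c ∘ sym) e≢a e≢b b≢a b₁≢a eb₁ bx b₁x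
            b₂≡c = next-back (f≢c ∘ sym) f≢a f≢b b≢a b₂≢a fb₂ bx b₂x
        in not-¬ (subst (λ z → arc T z f ≡ s) b₁≡c
                    (b₁x f≢a (λ f≡b₁ → f≢c (trans f≡b₁ b₁≡c)) f≢e))
                 (arc-flip T f≢c (subst (λ z → arc T f z ≡ s) b₂≡c fb₂))

    module _ {P N : Subset n} {y d : Fin n} (P∩N : ∀ {v} → v ∈ P → v ∉ N) (y∈P : y ∈ P)
      (d∈P : d ∈ P) (d≢y : d ≢ y) (mP : NontrivialModule T P) (¬mN : ¬ NontrivialModule T N)
      (mN∁ : NontrivialModule T (∁ N)) {p q : Fin n} (p∈N : p ∈ N) (q∈N : q ∈ N) (p≢q : p ≢ q)
      (obs : ∀ {e} → e ∈ N → Obstruction T P N y e ⊎ Obstruction T N P e y) where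

      private
        s = arc T y d

        -- What `outer-c` yields here: e is the only vertex that tells b from y.
        Separates : Fin n → Fin n → Set
        Separates e b = b ∈ N × b ≢ e × arc T b y ≡ s ×
          (∀ {v} → v ≢ y → v ≢ b → v ≢ e → arc T v y ≡ arc T v b) × arc T e y ≢ arc T e b

        -- What `outer-a` yields with the roles exchanged: e alone in N has sign s toward y, and N
        -- omits at most one vertex w besides y.
        OnlyIn : Fin n → Set
        OnlyIn e = arc T e y ≡ s × (∀ {v} → v ∈ N → v ≢ e → arc T v y ≡ not s) ×
          ∃[ w ] (∀ {x} → x ≢ y → x ≢ w → x ∈ N)

        cases : ∀ {e} → e ∈ N → (∃[ b ] Separates e b) ⊎ OnlyIn e
        cases e∈ with obs e∈
        ... | inj₁ (extreme _ _ _ _ mN _ _ _ _) = ⊥-elim (¬mN mN)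
        ... | inj₁ (outer-c b _ _ b∈ b≢e by tw sep) = inj₁ (b , b∈ , b≢e , by d∈P d≢y , tw , sep)
        ... | inj₁ (outer-a _ _ ¬mP _ _ _ _ _ _ _) = ⊥-elim (¬mP mP)
        ... | inj₂ (extreme _ _ _ all _ _ _ _ _) = ⊥-elim
          (p≢q (trans (single p∈N) (sym (single q∈N))))
          where
          single : ∀ {v} → v ∈ N → v ≡ _
          single {v} v∈ = decidable-stable (v ≟ᶠ _) λ v≢e → P∩N (all v≢e) v∈
        ... | inj₂ (outer-c _ ¬mP _ _ _ _ _ _) = ⊥-elim (¬mP mP)
        ... | inj₂ (outer-a s′ b _ _ b∈P b≢y out ey yb rest) =
          inj₂ (trans ey s′≡s , (λ v∈ v≢e → trans (rest v∈ v≢e) (cong not s′≡s)) ,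
            b , λ {x} x≢y x≢b → decidable-stable (x ∈? N) λ x∉ → [ x≢y , x≢b ]′ (out x∉))
          where
          s′≡s : s′ ≡ s
          s′≡s = trans (sym yb) ([ (λ d≡y → ⊥-elim (d≢y d≡y)) , (λ d≡b → cong (arc T y) (sym d≡b)) ]′ (out (P∩N d∈P)))

        y∉N : y ∉ N
        y∉N = P∩N y∈P

        -- Otherwise N looks uniform to y, hence to every vertex of the module ∁ N, and N is a
        -- module.
        ∃out : ∃[ o ] o ∈ N × arc T o y ≢ s
        ∃out with any? (λ o → (o ∈? N) ×-dec ¬? (arc T o y ≟ s))
        ... | yes h = h
        ... | no none = ⊥-elim (¬mN (nontrivial uni p∈N q∈N p≢q y∉N))
          where
          from : ∀ {x v} → x ∈ N → v ∉ N → arc T v x ≡ not s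
          from {x} {v} x∈ v∉ = arc-flip T (∈∉⇒≢ x∈ v∉) (trans
            (uniform mN∁ (x∉p⇒x∈∁p v∉) (x∉p⇒x∈∁p y∉N) (x∈p⇒x∉∁p x∈))
            (decidable-stable (arc T x y ≟ s) λ h → none (x , x∈ , h)))
            where open NontrivialModule
          uni : Uniform T N
          uni x∈ x′∈ v∉ = trans (from x∈ v∉) (sym (from x′∈ v∉))

        separates-injective : ∀ {e e′ b} → e ∈ N → Separates e b → Separates e′ b → e ≡ e′
        separates-injective {e} {e′} e∈ (_ , b≢e , _ , _ , sep) (_ , _ , _ , tw , _) =
          decidable-stable (e ≟ᶠ e′) λ e≢e′ → sep (tw (∈∉⇒≢ e∈ y∉N) (b≢e ∘ sym) e≢e′)

        chain : ∀ {e b x} → Separates e b → x ∈ N → x ≢ b → x ≢ e → arc T x y ≡ s → arc T x b ≡ s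
        chain (_ , _ , _ , tw , _) x∈ x≢b x≢e xy = trans (sym (tw (∈∉⇒≢ x∈ y∉N) x≢b x≢e)) xy

        -- A fresh o′ in N is not `OnlyIn`, as b alone has sign s toward y. Its partner has sign s
        -- too, so it is b, and injectivity gives o′ = o.
        only-in-impossible : ∀ {o b} → o ∈ N → arc T o y ≢ s → Separates o b → OnlyIn b → ⊥
        only-in-impossible {o} {b} o∈ oy sep (_ , rest , w , big) with fresh 5≤n y w b o
        ... | o′ , o′≢y , o′≢w , o′≢b , o′≢o with cases (big o′≢y o′≢w)
        ... | inj₂ (o′y , _) = not-¬ o′y (rest (big o′≢y o′≢w) o′≢b)
        ... | inj₁ (b′ , sep′) with b′ ≟ᶠ b
        ... | yes refl = o′≢o (separates-injective (big o′≢y o′≢w) sep′ sep)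
        ... | no b′≢b = not-¬ (proj₁ (proj₂ (proj₂ sep′))) (rest (proj₁ sep′) b′≢b)

      -- Partners are followed from o to b₀, b₁, b₂. If b₂ = b₀, then o = b₁, which has the wrong
      -- sign toward y. Otherwise `chain` gives sign s to both directions between b₀ and b₂.
      nonmodule-impossible : ⊥
      nonmodule-impossible with ∃out
      ... | o , o∈ , oy with cases o∈
      ... | inj₂ (oy′ , _) = oy oy′
      ... | inj₁ (b₀ , sep₀@(b₀∈ , b₀≢o , b₀y , _)) with cases b₀∈
      ... | inj₂ only = only-in-impossible o∈ oy sep₀ only
      ... | inj₁ (b₁ , sep₁@(b₁∈ , b₁≢b₀ , b₁y , _ , b₀-sep)) with cases b₁∈
      ... | inj₂ (_ , rest , _) = not-¬ b₀y (rest b₀∈ (b₁≢b₀ ∘ sym))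
      ... | inj₁ (b₂ , sep₂@(b₂∈ , b₂≢b₁ , b₂y , _)) with b₂ ≟ᶠ b₀
      ... | yes refl = oy (trans (cong (λ z → arc T z y) (separates-injective o∈ sep₀ sep₂)) b₁y)
      ... | no b₂≢b₀ = not-¬
        (chain sep₀ b₂∈ b₂≢b₀ (λ { refl → oy b₂y }) b₂y)
        (arc-flip T (b₂≢b₀ ∘ sym) (chain sep₂ b₀∈ (b₂≢b₀ ∘ sym) (b₁≢b₀ ∘ sym) b₀y))

    module _ {X : Subset n} (V : Valid T X) {a c : Fin n} (a∈X : a ∈ X) (c∈X : c ∈ X) (a≢c : a ≢ c)
      (X⊆ : ∀ {x} → x ∈ X → x ≡ a ⊎ x ≡ c) where

      open NontrivialModule

      resolve-extreme : ∀ {s} → (∀ {x} → x ≢ a → arc T a x ≡ s) → (∀ {x} → x ≢ a → x ∈ rep V c) →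
        NontrivialModule T (rep V c) → Good
      resolve-extreme ax big mN = exchange V a∈X c∈X a≢c X⊆ (isolated⇐large mcN big) covers′
        (extreme-impossible (disj V a∈X c∈X a≢c) big mN ax)
        where
        N = rep V c
        mcN = rep-mc V c∈X

        a∉N : a ∉ N
        a∉N h = a≢c (rep-once V c∈X a∈X h)

        covers′ : ∀ {e M} → e ∈ N → NontrivialModule T M → ∃[ y ] y ∈ M × y ∉ pair a e
        covers′ {e} {M} e∈ m with any? (λ y → (y ∈? M) ×-dec ¬? (y ∈? pair a e))
        ... | yes h = h
        -- Here M is {a , e}, and `N ─ M` is a nontrivial module properly inside N.
        ... | no none = ⊥-elim (mc-avoid T mcN
            (nontrivial⇒comodule T (nontrivial (─-uniform T (uniform mN) (uniform m) a∈M a∉N)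
              (rest z≢a z≢e) (rest w≢a w≢e) (w≢z ∘ sym) (λ h → proj₂ (∈─⁻ h) e∈M)))
            (p─q⊆p N M) e∈ (λ h → proj₂ (∈─⁻ h) e∈M))
          where
          M⊆ : ∀ {x} → x ∈ M → x ≡ a ⊎ x ≡ e
          M⊆ {x} x∈ = ∈²⁻ (decidable-stable (x ∈? pair a e) λ h → none (x , x∈ , h))

          e∈M : e ∈ M
          e∈M = let d , d∈ , d≢a = other T m a in [ (λ h → ⊥-elim (d≢a h)) , (λ h → subst (_∈ M) h d∈) ]′ (M⊆ d∈)
          a∈M : a ∈ M
          a∈M = let d , d∈ , d≢e = other T m e in [ (λ h → subst (_∈ M) h d∈) , (λ h → ⊥-elim (d≢e h)) ]′ (M⊆ d∈)

          zz = fresh 5≤n a e e e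
          z = proj₁ zz
          z≢a = proj₁ (proj₂ zz)
          z≢e = proj₁ (proj₂ (proj₂ zz))
          ww = fresh 5≤n a e z z
          w≢a = proj₁ (proj₂ ww)
          w≢e = proj₁ (proj₂ (proj₂ ww))
          w≢z = proj₁ (proj₂ (proj₂ (proj₂ ww)))

          rest : ∀ {x} → x ≢ a → x ≢ e → x ∈ N ─ M
          rest x≢a x≢e = x∈p∧x∉q⇒x∈p─q (big x≢a) ([ x≢a , x≢e ]′ ∘ M⊆)

      resolve-nonmodule : NontrivialModule T (rep V a) → ¬ NontrivialModule T (rep V c) →
        ∀ {b} → b ∈ rep V c → b ≢ c → Good
      resolve-nonmodule mP ¬mN {b} b∈ b≢c with other T mP a
      ... | d , d∈ , d≢a = exchange V a∈X c∈X a≢c X⊆ (isolated⇐nonmodule mcN ¬mN) covers′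
        (nonmodule-impossible (disj V a∈X c∈X a≢c) (∈rep V a∈X) d∈ d≢a mP ¬mN mN∁ b∈ (∈rep V c∈X) b≢c)
        where
        N = rep V c
        mcN = rep-mc V c∈X

        mN∁ : NontrivialModule T (∁ N)
        mN∁ = [ (λ m → ⊥-elim (¬mN m)) , (λ m → m) ]′ (mc-cases T mcN)

        a∉N : a ∉ N
        a∉N h = a≢c (rep-once V c∈X a∈X h)

        two : ∀ e → ∃[ w ] w ∈ N × w ≢ e
        two e with b ≟ᶠ e
        ... | yes refl = c , ∈rep V c∈X , b≢c ∘ sym
        ... | no b≢e = b , b∈ , b≢e

        covers′ : ∀ {e M} → e ∈ N → NontrivialModule T M → ∃[ y ] y ∈ M × y ∉ pair a e
        covers′ {e} {M} e∈ m with any? (λ y → (y ∈? M) ×-dec ¬? (y ∈? pair a e))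
        ... | yes h = h
        -- Here M is {a , e}; it shares a with the module ∁ N, and the complement of their union
        -- lies properly inside N.
        ... | no none = ⊥-elim (mc-avoid T mcN
            (nontrivial⇒comodule∁ T (nontrivial (∪-uniform T (uniform mN∁) (uniform m) (x∉p⇒x∈∁p a∉N) a∈M)
              (x∈p∪q⁺ (inj₂ a∈M)) (x∈p∪q⁺ {p = ∁ N} (inj₂ e∈M)) (∈∉⇒≢ e∈ a∉N ∘ sym)
              ([ x∈p⇒x∉∁p w∈ , ([ ∈∉⇒≢ w∈ a∉N , w≢e ]′ ∘ M⊆) ]′ ∘ x∈p∪q⁻ (∁ N) M)))
            (λ h → x∉∁p⇒x∈p (proj₁ (∉∪⁻ (x∈∁p⇒x∉p h)))) e∈
            (λ h → x∈∁p⇒x∉p h (x∈p∪q⁺ {p = ∁ N} (inj₂ e∈M))))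
          where
          M⊆ : ∀ {x} → x ∈ M → x ≡ a ⊎ x ≡ e
          M⊆ {x} x∈ = ∈²⁻ (decidable-stable (x ∈? pair a e) λ h → none (x , x∈ , h))

          e∈M : e ∈ M
          e∈M = let d , d∈ , d≢a = other T m a in [ (λ h → ⊥-elim (d≢a h)) , (λ h → subst (_∈ M) h d∈) ]′ (M⊆ d∈)
          a∈M : a ∈ M
          a∈M = let d , d∈ , d≢e = other T m e in [ (λ h → subst (_∈ M) h d∈) , (λ h → ⊥-elim (d≢e h)) ]′ (M⊆ d∈)

          ww = two e
          w∈ = proj₁ (proj₂ ww)
          w≢e = proj₂ (proj₂ ww)

    improve : ∀ {X} → Valid T X → Good
    improve {X} V with survivor? X
    ... | no none = X , V , no-survivor⇒indecomposable none
    ... | yes (M , bad) with Survivor.obstruction T V bad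
    ... | a , c , a∈X , c∈X , a≢c , X⊆ , extreme s b ax big mN _ _ _ _ =
      resolve-extreme V a∈X c∈X a≢c X⊆ ax big mN
    ... | a , c , a∈X , c∈X , a≢c , X⊆ , outer-c b ¬mN mP b∈ b≢c _ _ _ =
      resolve-nonmodule V a∈X c∈X a≢c X⊆ mP ¬mN b∈ b≢c
    ... | a , c , a∈X , c∈X , a≢c , X⊆ , outer-a s b ¬mP mN _ _ out _ _ _ =
      -- The roles of a and c are exchanged; w is the second vertex of `rep a`, outside which there
      -- are only b and c.
      let w , w≢a , w≢b , w≢c , _ = fresh 5≤n a b c c
      in resolve-nonmodule V c∈X a∈X (a≢c ∘ sym) ([ inj₂ , inj₁ ]′ ∘ X⊆) mN ¬mP
        (decidable-stable (w ∈? rep V a) λ w∉ → [ w≢c , w≢b ]′ (out w∉)) w≢a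

-- The transversal taking alternate twins

module Parity {n : ℕ} (R : Fin n → Fin n → Set) where

  -- Parity of the distance from the start of the path; for the reversed relation, from its end.
  data Odd (y : Fin n) : Set
  data Even (y : Fin n) : Set

  data Odd y where
    odd : ∀ {x} → R x y → Even x → Odd y

  data Even y where
    start : (∀ {x} → ¬ R x y) → Even y
    even  : ∀ {x} → R x y → Odd x → Even y

  parity : (∀ x y → Dec (R x y)) → WellFounded R → ∀ y → Odd y ⊎ Even y
  parity R? wf y = go (wf y)
    where
    go : ∀ {y} → Acc R y → Odd y ⊎ Even y
    go {y} (acc rec) with any? (λ x → R? x y)
    ... | no none = inj₂ (start λ {x} r → none (x , r))
    ... | yes (x , r) = [ inj₂ ∘ even r , inj₁ ∘ odd r ]′ (go (rec r))

  module _ (R-injective : ∀ {x x′ y} → R x y → R x′ y → x ≡ x′) where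

    ¬odd×even : ∀ {y} → Odd y → ¬ Even y
    ¬odd×even (odd r e) (start none) = none r
    ¬odd×even (odd r e) (even r′ o) with refl ← R-injective r r′ = ¬odd×even o e

    ¬next-odd : ∀ {x y} → R x y → Odd x → ¬ Odd y
    ¬next-odd r o (odd r′ e) with refl ← R-injective r r′ = ¬odd×even o e

module _ {n : ℕ} (T : Tournament n) where

  Twin : Fin n → Fin n → Set
  Twin u v = arc T u v ≡ true × mc T (pair u v) × NontrivialModule T (pair u v)

  twin? : ∀ u v → Dec (Twin u v)
  twin? u v = (arc T u v ≟ true) ×-dec mc? T (pair u v) ×-dec nontrivial? T (pair u v)

  arc≢ : ∀ {u v} → arc T u v ≡ true → u ≢ v
  arc≢ uv refl with () ← trans (sym uv) (arc-irrefl T)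

  twin-arc : ∀ {u v} → Twin u v → ∀ {w} → w ≢ u → w ≢ v → arc T w u ≡ arc T w v
  twin-arc (_ , _ , m) w≢u w≢v = uniform m ∈²ˡ ∈²ʳ (∉²⁺ w≢u w≢v)
    where open NontrivialModule

  -- Each of v, v′ sees u as it sees the other, so the arc between them would point in neither
  -- direction.
  twin-next : ∀ {u v v′} → Twin u v → Twin u v′ → v ≡ v′
  twin-next {u} {v} {v′} t t′ = decidable-stable (v ≟ᶠ v′) λ v≢v′ →
    not-¬ (half t t′ v≢v′) (arc-flip T v≢v′ (half t′ t (v≢v′ ∘ sym)) )
    where
    half : ∀ {w w′} → Twin u w → Twin u w′ → w ≢ w′ → arc T w′ w ≡ false
    half s s′ w≢w′ = trans (sym (twin-arc s (arc≢ (proj₁ s′) ∘ sym) (w≢w′ ∘ sym))) (arc-flip T (arc≢ (proj₁ s′)) (proj₁ s′))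

  twin-previous : ∀ {u u′ v} → Twin u v → Twin u′ v → u ≡ u′
  twin-previous {u} {u′} {v} t t′ = decidable-stable (u ≟ᶠ u′) λ u≢u′ →
    not-¬ (half t t′ u≢u′) (arc-flip T u≢u′ (half t′ t (u≢u′ ∘ sym)))
    where
    half : ∀ {w w′} → Twin w v → Twin w′ v → w ≢ w′ → arc T w′ w ≡ true
    half s s′ w≢w′ = trans (twin-arc s (w≢w′ ∘ sym) (arc≢ (proj₁ s′))) (proj₁ s′)

  private
    In : Fin n → Subset n
    In x = sub (λ w → arc T w x ≟ true)

    -- In-neighbourhoods grow strictly along twins, so there are no cycles and induction works in
    -- both directions.
    twin⇒⊂ : ∀ {u v} → Twin u v → In u ⊂ In v
    twin⇒⊂ {u} {v} t = below , u , ∈sub⁺ (λ w → arc T w v ≟ true) (proj₁ t) ,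
      λ u∈ → arc≢ (∈sub⁻ (λ w → arc T w u ≟ true) u∈) refl
      where
      below : In u ⊆ In v
      below {w} w∈ = ∈sub⁺ (λ w → arc T w v ≟ true) (trans (sym (twin-arc t (arc≢ wu) w≢v)) wu)
        where
        wu : arc T w u ≡ true
        wu = ∈sub⁻ (λ w → arc T w u ≟ true) w∈
        w≢v : w ≢ v
        w≢v refl = not-¬ wu (arc-flip T (arc≢ (proj₁ t)) (proj₁ t))

  twin-wellFounded : WellFounded Twin
  twin-wellFounded = Subrelation.wellFounded twin⇒⊂ (On.wellFounded In ⊂-wellFounded)

  twin-noetherian : WellFounded (λ u v → Twin v u)
  twin-noetherian = Subrelation.wellFounded twin⇒⊂ (On.wellFounded In ⊃-wellFounded)

  module Forward = Parity Twin
  module Backward = Parity (λ u v → Twin v u)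

  forward-parity : ∀ x → Forward.Odd x ⊎ Forward.Even x
  forward-parity = Forward.parity twin? twin-wellFounded

  backward-parity : ∀ x → Backward.Odd x ⊎ Backward.Even x
  backward-parity = Backward.parity (λ u v → twin? v u) twin-noetherian

  -- Sources, sinks and the ends of twin paths

  Extreme : Bool → Fin n → Set
  Extreme s a = ∀ {v} → v ≢ a → arc T a v ≡ s

  Second : Bool → Fin n → Fin n → Set
  Second s a x = Extreme s a × a ≢ x × (∀ {v} → v ≢ a → v ≢ x → arc T x v ≡ s)

  second? : ∀ s x → Dec (∃[ a ] Second s a x)
  second? s x = any? λ a → map′ (λ h {v} → h v) (λ h v → h {v}) (all? λ v → ¬? (v ≟ᶠ a) →-dec (arc T a v ≟ s))
    ×-dec ¬? (a ≟ᶠ x)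
    ×-dec map′ (λ h {v} → h v) (λ h v → h {v}) (all? λ v → ¬? (v ≟ᶠ a) →-dec (¬? (v ≟ᶠ x) →-dec (arc T x v ≟ s)))

  -- Along a maximal path of twins we take every other vertex, skipping the first one. This
  -- fails if the last vertex gets taken and forms a module with a sink of T: on the paths
  -- ending next to a sink, which make up Tail, we skip the last vertex instead. The failure at
  -- the first vertex, next to a source, then means that T is transitive of even order.
  data Tail (x : Fin n) : Set where
    end  : ∀ {z} → Second false z x → Tail x
    step : ∀ {y} → Twin x y → Tail y → Tail x

  tail? : ∀ x → Dec (Tail x)
  tail? x = go (twin-noetherian x)
    where
    go : ∀ {x} → Acc (λ u v → Twin v u) x → Dec (Tail x)
    go {x} (acc rec) with second? false x | any? (twin? x)
    ... | yes (_ , s) | _ = yes (end s)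
    ... | no ¬s | no none = no λ { (end s) → ¬s (_ , s) ; (step t _) → none (_ , t) }
    ... | no ¬s | yes (y , t) with go (rec t)
    ... | yes ty = yes (step t ty)
    ... | no ¬ty = no λ { (end s) → ¬s (_ , s) ; (step t′ ty) → ¬ty (subst Tail (twin-next t′ t) ty) }

  Below : Fin n → Fin n → Set
  Below x p = p ≡ x ⊎ arc T x p ≡ true

  below? : ∀ x p → Dec (Below x p)
  below? x p = (p ≟ᶠ x) ⊎-dec (arc T x p ≟ true)

  -- The closed out-neighbourhood. On a tail it has two elements at the last vertex and one more at
  -- each step back, which turns parity along the path into parity of n.
  Down : Fin n → Subset n
  Down x = sub (below? x)

  ∣Down∣-twin : ∀ {x y} → Twin x y → ∣ Down x ∣ ≡ suc ∣ Down y ∣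
  ∣Down∣-twin {x} {y} t = trans (cong ∣_∣ {x = Down x} {y = ⁅ x ⁆ ∪ Down y} (⊆-antisym to from)) (∣⁅x⁆∪p∣ {p = Down y} x∉)
    where
    yx : arc T y x ≡ false
    yx = arc-flip T (arc≢ (proj₁ t)) (proj₁ t)

    x∉ : x ∉ Down y
    x∉ h with ∈sub⁻ (below? y) h
    ... | inj₁ x≡y = arc≢ (proj₁ t) x≡y
    ... | inj₂ yx′ = not-¬ yx′ yx

    to : Down x ⊆ ⁅ x ⁆ ∪ Down y
    to {p} h with p ≟ᶠ x | p ≟ᶠ y | ∈sub⁻ (below? x) h
    ... | yes refl | _ | _ = x∈p∪q⁺ (inj₁ (x∈⁅x⁆ x))
    ... | no _ | yes refl | _ = x∈p∪q⁺ {p = ⁅ x ⁆} (inj₂ (∈sub⁺ (below? y) (inj₁ refl)))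
    ... | no p≢x | _ | inj₁ p≡x = ⊥-elim (p≢x p≡x)
    ... | no p≢x | no p≢y | inj₂ xp = x∈p∪q⁺ {p = ⁅ x ⁆} (inj₂ (∈sub⁺ (below? y) (inj₂
        (arc-flip T p≢y (trans (sym (twin-arc t p≢x p≢y)) (arc-flip T (p≢x ∘ sym) xp))))))

    from : ⁅ x ⁆ ∪ Down y ⊆ Down x
    from {p} h with x∈p∪q⁻ ⁅ x ⁆ (Down y) h
    ... | inj₁ p∈ = ∈sub⁺ (below? x) (inj₁ (x∈⁅y⁆⇒x≡y x p∈))
    ... | inj₂ p∈ with ∈sub⁻ (below? y) p∈
    ... | inj₁ refl = ∈sub⁺ (below? x) (inj₂ (proj₁ t))
    ... | inj₂ yp = ∈sub⁺ (below? x) (inj₂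
        (arc-flip T p≢x (trans (twin-arc t p≢x (arc≢ yp ∘ sym)) (arc-flip T (arc≢ yp) yp))))
      where
      p≢x : p ≢ x
      p≢x refl = not-¬ yp yx

  ∣Down∣-second : ∀ {z w} → Second false z w → ∣ Down w ∣ ≡ 2
  ∣Down∣-second {z} {w} (ez , z≢w , rest) = trans (cong ∣_∣ {x = Down w} {y = pair w z} (⊆-antisym to from))
    (trans (∣⁅x⁆∪p∣ {p = ⁅ z ⁆} (λ h → z≢w (sym (x∈⁅y⁆⇒x≡y z h)))) (cong suc (∣⁅x⁆∣≡1 z)))
    where
    to : Down w ⊆ pair w z
    to {p} h with p ≟ᶠ z | ∈sub⁻ (below? w) h
    ... | yes refl | _ = ∈²ʳ
    ... | no _ | inj₁ refl = ∈²ˡ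
    ... | no p≢z | inj₂ wp = ⊥-elim (not-¬ wp (rest p≢z (arc≢ wp ∘ sym)))

    from : pair w z ⊆ Down w
    from h with ∈²⁻ h
    ... | inj₁ refl = ∈sub⁺ (below? w) (inj₁ refl)
    ... | inj₂ refl = ∈sub⁺ (below? w) (inj₂ (arc-flip T z≢w (ez (z≢w ∘ sym))))

  ¬below-into : ∀ {x v} → Below x v → arc T v x ≢ true
  ¬below-into (inj₁ refl) vx = arc≢ vx refl
  ¬below-into (inj₂ xv) vx = not-¬ vx (arc-flip T (arc≢ xv) xv)

  -- Below x, the vertex x dominates all others, and these are the vertices below the next twin y.
  -- At the end of the path only two vertices are left.
  Below-transitive : ∀ {x} → Tail x → ∀ {p q r} → Below x p → Below x q → Below x r →
    arc T p q ≡ true → arc T q r ≡ true → arc T p r ≡ true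
  Below-transitive (end {z} (ez , z≢w , rest)) {p} {q} {r} p∈ q∈ r∈ pq qr = ⊥-elim (by-q (only q∈))
    where
    only : ∀ {p} → Below _ p → p ≡ z ⊎ p ≡ _
    only (inj₁ p≡w) = inj₂ p≡w
    only {p} (inj₂ wp) = inj₁ (decidable-stable (p ≟ᶠ z) λ p≢z → not-¬ wp (rest p≢z (arc≢ wp ∘ sym)))
    z-out : ∀ {v} → arc T z v ≢ true
    z-out zv = not-¬ zv (ez (arc≢ zv ∘ sym))
    by-q : q ≡ z ⊎ q ≡ _ → ⊥
    by-q (inj₁ refl) = z-out qr
    by-q (inj₂ refl) = [ (λ { refl → z-out pq }) , (λ p≡w → arc≢ pq p≡w) ]′ (only p∈)
  Below-transitive {x} (step {y} t ty) {p} {q} {r} p∈ q∈ r∈ pq qr with p ≟ᶠ x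
  ... | yes refl = [ (λ { refl → ⊥-elim (¬below-into q∈ qr) }) , (λ xr → xr) ]′ r∈
  ... | no p≢x = Below-transitive ty (down p∈ p≢x) (down q∈ q≢x) (down r∈ r≢x) pq qr
    where
    q≢x : q ≢ x
    q≢x refl = ¬below-into p∈ pq
    r≢x : r ≢ x
    r≢x refl = ¬below-into q∈ qr
    down : ∀ {v} → Below x v → v ≢ x → Below y v
    down (inj₁ v≡x) v≢x = ⊥-elim (v≢x v≡x)
    down {v} (inj₂ xv) v≢x with v ≟ᶠ y
    ... | yes v≡y = inj₁ v≡y
    ... | no v≢y = inj₂ (arc-flip T v≢y (trans (sym (twin-arc t v≢x v≢y)) (arc-flip T (v≢x ∘ sym) xv)))

  module _ (5≤n : 5 ≤ n) where

    extreme⇒nontrivial : ∀ {s a} → Extreme s a → NontrivialModule T (∁ ⁅ a ⁆)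
    extreme⇒nontrivial {s} {a} ea =
      let x , x≢a , _ = fresh 5≤n a a a a
          y , y≢a , y≢x , _ = fresh 5≤n a x x x
      in nontrivial uni (x∉p⇒x∈∁p (x≢a ∘ x∈⁅y⁆⇒x≡y a)) (x∉p⇒x∈∁p (y≢a ∘ x∈⁅y⁆⇒x≡y a)) (y≢x ∘ sym)
        (x∈p⇒x∉∁p (x∈⁅x⁆ a))
      where
      uni : Uniform T (∁ ⁅ a ⁆)
      uni x∈ y∈ v∉ with refl ← x∈⁅y⁆⇒x≡y a (x∉∁p⇒x∈p v∉) = trans (to x∈) (sym (to y∈))
        where
        to : ∀ {x} → x ∈ ∁ ⁅ a ⁆ → arc T a x ≡ s
        to x∈ = ea (λ { refl → x∈∁p⇒x∉p x∈ (x∈⁅x⁆ a) })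

    -- {a} is a co-module, so a lies in no larger minimal one.
    extreme-avoids : ∀ {s a N x} → Extreme s a → mc T N → x ∈ N → x ≢ a → a ∉ N
    extreme-avoids {a = a} ea mcN x∈N x≢a a∈N = mc-avoid T mcN (nontrivial∁⇒comodule T (extreme⇒nontrivial ea))
      (λ h → subst (_∈ _) (sym (x∈⁅y⁆⇒x≡y a h)) a∈N) x∈N (x≢a ∘ x∈⁅y⁆⇒x≡y a)

    second-last : ∀ {z w y} → Second false z w → ¬ Twin w y
    second-last {z} {w} {y} (ez , z≢w , rest) (wy , mcp , _) with y ≟ᶠ z
    ... | yes refl = extreme-avoids ez mcp ∈²ˡ (z≢w ∘ sym) ∈²ʳ
    ... | no y≢z = not-¬ wy (rest y≢z (arc≢ wy ∘ sym))

    second-first : ∀ {a x w} → Second true a x → ¬ Twin w x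
    second-first {a} {x} {w} (ea , a≢x , rest) (wx , mcp , _) with w ≟ᶠ a
    ... | yes refl = extreme-avoids ea mcp ∈²ʳ (a≢x ∘ sym) ∈²ˡ
    ... | no w≢a = not-¬ wx (arc-flip T (arc≢ wx ∘ sym) (rest w≢a (arc≢ wx)))

    tail-next : ∀ {x y} → Twin x y → Tail x → Tail y
    tail-next t (end s) = ⊥-elim (second-last s t)
    tail-next t (step t′ ty) = subst Tail (twin-next t′ t) ty

    mutual
      even-∣Down∣ : ∀ {x} → Backward.Even x → Tail x → 2 ∣ (∣ Down x ∣)
      even-∣Down∣ (Backward.start none) (step t _) = ⊥-elim (none t)
      even-∣Down∣ (Backward.start none) (end s) = subst (2 ∣_) (sym (∣Down∣-second s)) ∣-refl
      even-∣Down∣ (Backward.even t o) tx = subst (2 ∣_) (sym (∣Down∣-twin t)) (odd-∣Down∣ o (tail-next t tx))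

      odd-∣Down∣ : ∀ {x} → Backward.Odd x → Tail x → 2 ∣ (suc ∣ Down x ∣)
      odd-∣Down∣ (Backward.odd t e) tx =
        subst (λ k → 2 ∣ (suc k)) (sym (∣Down∣-twin t)) (∣m∣n⇒∣m+n ∣-refl (even-∣Down∣ e (tail-next t tx)))

    -- All vertices other than the source a lie in `Down x`, so n is one more than its size.
    transitive-even : ∀ {a x} → Second true a x → Tail x → Backward.Odd x → IsTransitive T × 2 ∣ n
    transitive-even {a} {x} (ea , a≢x , rest) tx o =
      (λ {p} {q} {r} pq qr → arc⁻ T (tr′ (arc⁺ T pq) (arc⁺ T qr))) , subst (2 ∣_) size (odd-∣Down∣ o tx)
      where
      a∉Down : a ∉ Down x
      a∉Down h with ∈sub⁻ (below? x) h
      ... | inj₁ a≡x = a≢x a≡x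
      ... | inj₂ xa = not-¬ xa (arc-flip T a≢x (ea (a≢x ∘ sym)))

      below-x : ∀ {v} → v ≢ a → Below x v
      below-x {v} v≢a with v ≟ᶠ x
      ... | yes v≡x = inj₁ v≡x
      ... | no v≢x = inj₂ (rest v≢a v≢x)

      all∈ : full ⊆ ⁅ a ⁆ ∪ Down x
      all∈ {v} _ with v ≟ᶠ a
      ... | yes refl = x∈p∪q⁺ (inj₁ (x∈⁅x⁆ a))
      ... | no v≢a = x∈p∪q⁺ {p = ⁅ a ⁆} (inj₂ (∈sub⁺ (below? x) (below-x v≢a)))

      size : suc ∣ Down x ∣ ≡ n
      size = trans (sym (∣⁅x⁆∪p∣ {x = a} {p = Down x} a∉Down))
        (trans (cong ∣_∣ {x = ⁅ a ⁆ ∪ Down x} {y = full} (⊆-antisym ⊆⊤ all∈)) (∣⊤∣≡n n))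

      into-a : ∀ {v} → arc T v a ≢ true
      into-a va = not-¬ va (arc-flip T (arc≢ va ∘ sym) (ea (arc≢ va)))

      tr′ : ∀ {p q r} → arc T p q ≡ true → arc T q r ≡ true → arc T p r ≡ true
      tr′ {p} {q} {r} pq qr with p ≟ᶠ a
      ... | yes refl = ea (λ { refl → into-a qr })
      ... | no p≢a = Below-transitive tx (below-x p≢a) (below-x (λ { refl → into-a pq })) (below-x (λ { refl → into-a qr })) pq qr

    -- Chosen vertices and the minimal co-modules they represent

    Chosen : Fin n → Set
    Chosen x = (Tail x × Backward.Odd x) ⊎ (¬ Tail x × Forward.Odd x)

    chosen-one : ∀ {u v} → Twin u v → Chosen u ⊎ Chosen v
    chosen-one {u} {v} t with tail? u
    ... | yes tu = [ (λ o → inj₂ (inj₁ (tail-next t tu , o))) , (λ o → inj₁ (inj₁ (tu , o))) ]′ (Sum.map₂ (Backward.odd t) (backward-parity _))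
    ... | no ¬tu = [ (λ o → inj₁ (inj₂ (¬tu , o))) , (λ o → inj₂ (inj₂ (¬tu ∘ step t , o))) ]′ (Sum.map₂ (Forward.odd t) (forward-parity _))

    chosen-once : ∀ {u v} → Twin u v → Chosen u → ¬ Chosen v
    chosen-once t (inj₁ (_ , o)) (inj₁ (_ , o′)) = Backward.¬next-odd twin-next t o′ o
    chosen-once t (inj₂ (_ , o)) (inj₂ (_ , o′)) = Forward.¬next-odd twin-previous t o o′
    chosen-once t (inj₁ (tu , _)) (inj₂ (¬tv , _)) = ¬tv (tail-next t tu)
    chosen-once t (inj₂ (¬tu , _)) (inj₁ (tv , _)) = ¬tu (step t tv)

    -- Next to a source, x is the first vertex of its twin path; next to a sink, the last. It is
    -- thus the skipped end, unless a tail also begins next to a source and has x at odd distance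
    -- from its end.
    chosen-not-second : ¬ (IsTransitive T × 2 ∣ n) → ∀ {s a x} → Second s a x → ¬ Chosen x
    chosen-not-second ¬te {true} sec (inj₁ (tx , o)) = ¬te (transitive-even sec tx o)
    chosen-not-second ¬te {true} sec (inj₂ (_ , Forward.odd t _)) = second-first sec t
    chosen-not-second ¬te {false} sec (inj₁ (_ , Backward.odd t _)) = second-last sec t
    chosen-not-second ¬te {false} sec (inj₂ (¬tx , _)) = ¬tx (end sec)

    NonTwin : Subset n → Set
    NonTwin N = mc T N × ¬ (∃[ u ] ∃[ v ] Twin u v × N ≡ pair u v)

    nonTwin? : ∀ N → Dec (NonTwin N)
    nonTwin? N = mc? T N ×-dec ¬? (any? λ u → any? λ v → twin? u v ×-dec ≡-dec _≟_ N (pair u v))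

    mc-twin : ∀ {N} → mc T N → (∃[ u ] ∃[ v ] Twin u v × N ≡ pair u v) ⊎ NonTwin N
    mc-twin {N} mcN with any? (λ u → any? λ v → twin? u v ×-dec ≡-dec _≟_ N (pair u v))
    ... | yes h = inj₁ h
    ... | no none = inj₂ (mcN , none)

    small⇒twin : ∀ {N u x} → mc T N → NontrivialModule T N → u ∈ N → x ∈ N → u ≢ x →
      (∀ {y} → y ∈ N → y ≡ u ⊎ y ≡ x) → ∃[ u ] ∃[ v ] Twin u v × N ≡ pair u v
    small⇒twin {N} {u} {x} mcN m u∈ x∈ u≢x small = by-arc (arc T u x) refl
      where
      ordered : ∀ {u x} → u ∈ N → x ∈ N → (∀ {y} → y ∈ N → y ≡ u ⊎ y ≡ x) → arc T u x ≡ true →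
        ∃[ u ] ∃[ v ] Twin u v × N ≡ pair u v
      ordered {u} {x} u∈ x∈ small ux = u , x , (ux , subst (mc T) N≡ mcN , subst (NontrivialModule T) N≡ m) , N≡
        where
        N≡ : N ≡ pair u x
        N≡ = ⊆-antisym (λ y∈ → [ (λ { refl → ∈²ˡ }) , (λ { refl → ∈²ʳ }) ]′ (small y∈))
          (λ y∈ → [ (λ { refl → u∈ }) , (λ { refl → x∈ }) ]′ (∈²⁻ y∈))

      by-arc : ∀ b → arc T u x ≡ b → ∃[ u ] ∃[ v ] Twin u v × N ≡ pair u v
      by-arc true ux = ordered u∈ x∈ small ux
      by-arc false ux = ordered x∈ u∈ ([ inj₂ , inj₁ ]′ ∘ small) (arc-flip T u≢x ux)

    nonTwin-isolated : ∀ {N K v} → NonTwin N → mc T K → v ∈ K → v ∈ N → K ≡ N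
    nonTwin-isolated {N} {K} {v} (mcN , none) mcK v∈K v∈N = decidable-stable (≡-dec _≟_ K N) λ K≢N →
      let m , u , u∈N , u∉K , small = mc-meeting T mcN mcK (K≢N ∘ sym) v∈N v∈K
      in none (small⇒twin mcN m u∈N v∈N (∈∉⇒≢ v∈K u∉K ∘ sym) small)

    mc-nonempty : ∀ {N} → mc T N → Nonempty N
    mc-nonempty {N} mcN with mc-cases T mcN
    ... | inj₁ (nontrivial _ p∈ _ _ _) = _ , p∈
    ... | inj₂ (nontrivial _ _ _ _ r∉) = _ , x∉∁p⇒x∈p r∉

    abstract

      pick : Subset n → Fin n
      pick N with nonempty? N
      ... | yes (x , _) = x
      ... | no _ = first 5≤n
        where
        first : ∀ {m} → 5 ≤ m → Fin m
        first (s≤s _) = Fin.zero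

      pick-∈ : ∀ {N} → mc T N → pick N ∈ N
      pick-∈ {N} mcN with nonempty? N
      ... | yes (_ , x∈) = x∈
      ... | no empty = ⊥-elim (empty (mc-nonempty mcN))

    -- A chosen vertex is paired with its skipped neighbour on the side from which the distance is
    -- counted, so the pairs along a path are disjoint.
    data Represents (x : Fin n) : Subset n → Set where
      by-next     : ∀ {w} → Tail x → Twin x w → Backward.Even w → Represents x (pair x w)
      by-previous : ∀ {w} → ¬ Tail x → Twin w x → Forward.Even w → Represents x (pair w x)
      by-pick     : ∀ {N} → NonTwin N → pick N ≡ x → Represents x N

    chosen⇒represents : ∀ {x} → Chosen x → ∃[ N ] Represents x N
    chosen⇒represents (inj₁ (tx , Backward.odd t e)) = _ , by-next tx t e
    chosen⇒represents (inj₂ (¬tx , Forward.odd t e)) = _ , by-previous ¬tx t e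

    represents⇒ : ∀ {x N} → Represents x N → Chosen x ⊎ NonTwin N × pick N ≡ x
    represents⇒ (by-next tx t e) = inj₁ (inj₁ (tx , Backward.odd t e))
    represents⇒ (by-previous ¬tx t e) = inj₁ (inj₂ (¬tx , Forward.odd t e))
    represents⇒ (by-pick non eq) = inj₂ (non , eq)

    chosen? : ∀ x → Dec (Chosen x)
    chosen? x with tail? x | backward-parity x | forward-parity x
    ... | yes tx | inj₁ o | _ = yes (inj₁ (tx , o))
    ... | yes tx | inj₂ e | _ = no λ { (inj₁ (_ , o)) → Backward.¬odd×even twin-next o e ; (inj₂ (¬tx , _)) → ¬tx tx }
    ... | no ¬tx | _ | inj₁ o = yes (inj₂ (¬tx , o))
    ... | no ¬tx | _ | inj₂ e = no λ { (inj₁ (tx , _)) → ¬tx tx ; (inj₂ (_ , o)) → Forward.¬odd×even twin-previous o e }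

    represented? : ∀ x → Dec (∃[ N ] Represents x N)
    represented? x with chosen? x | anySubset? (λ N → nonTwin? N ×-dec (pick N ≟ᶠ x))
    ... | yes ch | _ = yes (chosen⇒represents ch)
    ... | no _ | yes (N , non , eq) = yes (N , by-pick non eq)
    ... | no ¬ch | no none = no λ (N , r) → [ ¬ch , (λ h → none (N , h)) ]′ (represents⇒ r)

    represents-mc : ∀ {x N} → Represents x N → mc T N
    represents-mc (by-next _ (_ , mcp , _) _) = mcp
    represents-mc (by-previous _ (_ , mcp , _) _) = mcp
    represents-mc (by-pick (mcN , _) _) = mcN

    represents-∈ : ∀ {x N} → Represents x N → x ∈ N
    represents-∈ (by-next _ _ _) = ∈²ˡ
    represents-∈ (by-previous _ _ _) = ∈²ʳ
    represents-∈ (by-pick (mcN , _) refl) = pick-∈ mcN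

    twin-meets-pick : ∀ {N u v w} → NonTwin N → Twin u v → w ∈ pair u v → w ∉ N
    twin-meets-pick non t@(_ , mcp , _) w∈ w∈N = proj₂ non (_ , _ , t , sym (nonTwin-isolated non mcp w∈ w∈N))

    represents-disjoint : ∀ {x y N K v} → Represents x N → Represents y K → x ≢ y → v ∈ N → v ∉ K
    represents-disjoint (by-pick non refl) (by-pick non′ refl) x≢y v∈ v∈′ =
      x≢y (cong pick (nonTwin-isolated non′ (proj₁ non) v∈ v∈′))
    represents-disjoint (by-pick non _) (by-next _ t _) _ v∈ v∈′ = twin-meets-pick non t v∈′ v∈
    represents-disjoint (by-pick non _) (by-previous _ t _) _ v∈ v∈′ = twin-meets-pick non t v∈′ v∈
    represents-disjoint (by-next _ t _) (by-pick non _) _ v∈ v∈′ = twin-meets-pick non t v∈ v∈′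
    represents-disjoint (by-previous _ t _) (by-pick non _) _ v∈ v∈′ = twin-meets-pick non t v∈ v∈′
    represents-disjoint (by-next tx t e) (by-next ty t′ e′) x≢y v∈ v∈′ with ∈²⁻ v∈ | ∈²⁻ v∈′
    ... | inj₁ refl | inj₁ refl = x≢y refl
    ... | inj₁ refl | inj₂ refl = Backward.¬odd×even twin-next (Backward.odd t e) e′
    ... | inj₂ refl | inj₁ refl = Backward.¬odd×even twin-next (Backward.odd t′ e′) e
    ... | inj₂ refl | inj₂ refl = x≢y (twin-previous t t′)
    represents-disjoint (by-previous _ t e) (by-previous _ t′ e′) x≢y v∈ v∈′ with ∈²⁻ v∈ | ∈²⁻ v∈′
    ... | inj₁ refl | inj₁ refl = x≢y (twin-next t t′)
    ... | inj₁ refl | inj₂ refl = Forward.¬odd×even twin-previous (Forward.odd t′ e′) e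
    ... | inj₂ refl | inj₁ refl = Forward.¬odd×even twin-previous (Forward.odd t e) e′
    ... | inj₂ refl | inj₂ refl = x≢y refl
    represents-disjoint (by-next tx t _) (by-previous ¬ty t′ _) _ v∈ v∈′ with ∈²⁻ v∈ | ∈²⁻ v∈′
    ... | inj₁ refl | inj₁ refl = ¬ty (tail-next t′ tx)
    ... | inj₁ refl | inj₂ refl = ¬ty tx
    ... | inj₂ refl | inj₁ refl = ¬ty (tail-next t′ (tail-next t tx))
    ... | inj₂ refl | inj₂ refl = ¬ty (tail-next t tx)
    represents-disjoint (by-previous ¬tx t _) (by-next ty t′ _) _ v∈ v∈′ with ∈²⁻ v∈ | ∈²⁻ v∈′
    ... | inj₁ refl | inj₁ refl = ¬tx (tail-next t ty)
    ... | inj₁ refl | inj₂ refl = ¬tx (tail-next t (tail-next t′ ty))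
    ... | inj₂ refl | inj₁ refl = ¬tx ty
    ... | inj₂ refl | inj₂ refl = ¬tx (tail-next t′ ty)

    abstract

      X₀ : Subset n
      X₀ = sub represented?

      in-X₀ : ∀ {x N} → Represents x N → x ∈ X₀
      in-X₀ r = ∈sub⁺ represented? (_ , r)

      rep₀ : Fin n → Subset n
      rep₀ x with represented? x
      ... | yes (N , _) = N
      ... | no _ = ∅

      represents-rep₀ : ∀ {x} → x ∈ X₀ → Represents x (rep₀ x)
      represents-rep₀ {x} x∈ with represented? x | ∈sub⁻ represented? x∈
      ... | yes (_ , r) | _ = r
      ... | no none | h = ⊥-elim (none h)

    meets₀ : ∀ {N} → mc T N → ∃[ x ] x ∈ X₀ × x ∈ N
    meets₀ {N} mcN with mc-twin mcN
    ... | inj₂ non = pick N , in-X₀ (by-pick non refl) , pick-∈ mcN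
    ... | inj₁ (u , v , t , refl) =
      [ (λ ch → u , in-X₀ (proj₂ (chosen⇒represents ch)) , ∈²ˡ)
      , (λ ch → v , in-X₀ (proj₂ (chosen⇒represents ch)) , ∈²ʳ) ]′ (chosen-one t)

    represents-nonTwin : ∀ {x K N} → NonTwin N → Represents x K → x ∈ N → pick N ≡ x
    represents-nonTwin non (by-next _ t _) x∈ = ⊥-elim (twin-meets-pick non t ∈²ˡ x∈)
    represents-nonTwin non (by-previous _ t _) x∈ = ⊥-elim (twin-meets-pick non t ∈²ʳ x∈)
    represents-nonTwin non r@(by-pick (mcK , _) refl) x∈ =
      cong pick (sym (nonTwin-isolated non mcK (represents-∈ r) x∈))

    represents-twin : ∀ {x K u v} → Twin u v → Represents x K → x ∈ pair u v → Chosen x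
    represents-twin t (by-next tx t′ e) _ = inj₁ (tx , Backward.odd t′ e)
    represents-twin t (by-previous ¬tx t′ e) _ = inj₂ (¬tx , Forward.odd t′ e)
    represents-twin t r@(by-pick non refl) x∈ = ⊥-elim (twin-meets-pick non t x∈ (represents-∈ r))

    once₀ : ∀ {N x y} → mc T N → x ∈ X₀ → y ∈ X₀ → x ∈ N → y ∈ N → x ≡ y
    once₀ {N} {x} {y} mcN x∈ y∈ x∈N y∈N with mc-twin mcN
    ... | inj₂ non = trans (sym (represents-nonTwin non (represents-rep₀ x∈) x∈N))
      (represents-nonTwin non (represents-rep₀ y∈) y∈N)
    ... | inj₁ (u , v , t , refl)
      with represents-twin t (represents-rep₀ x∈) x∈N | represents-twin t (represents-rep₀ y∈) y∈N | ∈²⁻ x∈N | ∈²⁻ y∈N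
    ... | _ | _ | inj₁ refl | inj₁ refl = refl
    ... | _ | _ | inj₂ refl | inj₂ refl = refl
    ... | cx | cy | inj₁ refl | inj₂ refl = ⊥-elim (chosen-once t cx cy)
    ... | cx | cy | inj₂ refl | inj₁ refl = ⊥-elim (chosen-once t cy cx)

    -- A nontrivial module M inside X₀ would be {a , b} with Second s a b.
    module Inside {M : Subset n} (m : NontrivialModule T M) (M⊆X : ∀ {x} → x ∈ M → x ∈ X₀) where
      open NontrivialModule

      -- A minimal co-module inside X₀ is a singleton, as X₀ meets it once. So its complement is a
      -- module, and its vertex is a source or a sink.
      extreme-in : ∀ {K} → K ⊆ M → NontrivialModule T K → ∃[ a ] ∃[ s ] a ∈ K × Extreme s a
      extreme-in {K} K⊆M mK with mc-below T (nontrivial⇒comodule T mK)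
      ... | N , mcN , N⊆K with meets₀ mcN
      ... | a , a∈X , a∈N with mc-cases T mcN
      ... | inj₁ mN = ⊥-elim (p≢q mN (once₀ mcN (M⊆X (K⊆M (N⊆K (p∈ mN)))) (M⊆X (K⊆M (N⊆K (q∈ mN)))) (p∈ mN) (q∈ mN)))
      ... | inj₂ mN∁ = a , arc T a (p mN∁) , N⊆K a∈N , λ {v} v≢a →
        uniform mN∁ (x∉p⇒x∈∁p (λ v∈N → v≢a (once₀ mcN (M⊆X (K⊆M (N⊆K v∈N))) a∈X v∈N a∈N)))
          (p∈ mN∁) (x∈p⇒x∉∁p a∈N)

      module _ {a s b} (a∈M : a ∈ M) (ea : Extreme s a) (b∈M : b ∈ M) (b≢a : b ≢ a) where

        -- With a third vertex, M without a would still be a module and contain an extreme a′. Then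
        -- a and a′ have opposite signs, but a vertex outside M sees them alike.
        M⊆pair : ∀ {v} → v ∈ M → v ≢ a → v ≡ b
        M⊆pair {v} v∈M v≢a = decidable-stable (v ≟ᶠ b) λ v≢b →
          let a′ , s′ , a′∈ , ea′ = extreme-in (p─q⊆p M ⁅ a ⁆)
                (nontrivial uni (rest b∈M b≢a) (rest v∈M v≢a) (v≢b ∘ sym) (λ h → proj₂ (∈─⁻ h) (x∈⁅x⁆ a)))
              a′∈M , a′∉ = ∈─⁻ a′∈
              a≢a′ : a ≢ a′
              a≢a′ a≡a′ = a′∉ (subst (_∈ ⁅ a ⁆) a≡a′ (x∈⁅x⁆ a))
          in not-¬
            (trans (sym (ea′ (∈∉⇒≢ a′∈M (r∉ m) ∘ sym)))
              (trans (uniform-flip T (uniform m) a′∈M a∈M (r∉ m)) (ea (∈∉⇒≢ a∈M (r∉ m) ∘ sym))))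
            (trans (sym (ea′ a≢a′)) (arc-flip T a≢a′ (ea (a≢a′ ∘ sym))))
          where
          rest : ∀ {x} → x ∈ M → x ≢ a → x ∈ M ─ ⁅ a ⁆
          rest x∈ x≢a = x∈p∧x∉q⇒x∈p─q x∈ (x≢a ∘ x∈⁅y⁆⇒x≡y a)

          uni : Uniform T (M ─ ⁅ a ⁆)
          uni {v = w} x∈ y∈ w∉ with w ≟ᶠ a | ∈─⁻ x∈ | ∈─⁻ y∈
          ... | yes refl | _ , x∉ | _ , y∉ =
            trans (ea (λ { refl → x∉ (x∈⁅x⁆ a) })) (sym (ea (λ { refl → y∉ (x∈⁅x⁆ a) })))
          ... | no w≢a | x∈M , _ | y∈M , _ = uniform m x∈M y∈M (λ w∈M → w∉ (rest w∈M w≢a))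

        second-b : Second s a b
        second-b = ea , b≢a ∘ sym , λ {v} v≢a v≢b →
          trans (uniform-flip T (uniform m) b∈M a∈M (λ v∈M → v≢b (M⊆pair v∈M v≢a))) (ea v≢a)

        -- If K is a module, so is `K ─ M`, which by minimality is a single vertex, and K is a twin.
        -- If not, ∁ K is a module containing a: a further vertex v outside K would look to b like
        -- a, and one inside K makes K a module, disjoint from the co-module {a}.
        not-picked : ∀ {K} → NonTwin K → b ∉ K
        not-picked {K} non b∈K with nontrivial? T K
        ... | yes mK = proj₂ non (small⇒twin (proj₁ non) mK d∈ b∈K d≢b small)
          where
          d = proj₁ (other T mK b)
          d∈ = proj₁ (proj₂ (other T mK b))
          d≢b = proj₂ (proj₂ (other T mK b))

          a∉K : a ∉ K
          a∉K = extreme-avoids ea (proj₁ non) b∈K b≢a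

          off-b : ∀ {y} → y ∈ K → y ≢ b → y ∈ K ─ M
          off-b y∈ y≢b = x∈p∧x∉q⇒x∈p─q y∈ (λ y∈M → y≢b (M⊆pair y∈M (∈∉⇒≢ y∈ a∉K)))

          small : ∀ {y} → y ∈ K → y ≡ d ⊎ y ≡ b
          small {y} y∈ with y ≟ᶠ b
          ... | yes y≡b = inj₂ y≡b
          ... | no y≢b = inj₁ (decidable-stable (y ≟ᶠ d) λ y≢d →
            mc-avoid T (proj₁ non)
              (nontrivial⇒comodule T (nontrivial (─-uniform T (uniform mK) (uniform m) a∈M a∉K)
                (off-b y∈ y≢b) (off-b d∈ d≢b) y≢d (λ h → proj₂ (∈─⁻ h) b∈M)))
              (p─q⊆p K M) b∈K (λ h → proj₂ (∈─⁻ h) b∈M))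
        ... | no ¬mK with fresh 5≤n a b b b | mc-cases T (proj₁ non)
        ... | _ | inj₁ mK = ¬mK mK
        ... | v , v≢a , v≢b , _ | inj₂ cK with v ∈? K
        ... | yes v∈K = ¬mK (nontrivial
              (disjoint-comodules-uniform T cK (extreme⇒nontrivial ea) (λ w∈K w∈a → a∉K (subst (_∈ K) (x∈⁅y⁆⇒x≡y a w∈a) w∈K)))
              v∈K b∈K v≢b a∉K)
          where
          a∉K : a ∉ K
          a∉K = extreme-avoids ea (proj₁ non) b∈K b≢a
        ... | no v∉K = not-¬
          (trans (uniform cK (x∉p⇒x∈∁p (extreme-avoids ea (proj₁ non) b∈K b≢a)) (x∉p⇒x∈∁p v∉K) (x∈p⇒x∉∁p b∈K))
            (proj₂ (proj₂ second-b) v≢a v≢b))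
          (arc-flip T (b≢a ∘ sym) (ea b≢a))

      impossible : ¬ (IsTransitive T × 2 ∣ n) → ⊥
      impossible ¬te =
        let a , s , a∈M , ea = extreme-in (λ x∈ → x∈) m
            b , b∈M , b≢a = other T m a
        in [ chosen-not-second ¬te (second-b a∈M ea b∈M b≢a)
           , (λ (non , eq) → not-picked a∈M ea b∈M b≢a non
               (subst (_∈ rep₀ b) eq (pick-∈ (proj₁ non)))) ]′ (represents⇒ (represents-rep₀ (M⊆X b∈M)))

    valid₀ : ¬ (IsTransitive T × 2 ∣ n) → Valid T X₀
    valid₀ ¬te = record
      { rep = rep₀
      ; rep-mc = represents-mc ∘ represents-rep₀
      ; ∈rep = represents-∈ ∘ represents-rep₀
      ; disj = λ x∈ y∈ → represents-disjoint (represents-rep₀ x∈) (represents-rep₀ y∈)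
      ; meets = meets₀
      ; once = once₀
      ; covers = covers₀
      }
      where
      covers₀ : ∀ {M} → NontrivialModule T M → ∃[ y ] y ∈ M × y ∉ X₀
      covers₀ {M} m with any? (λ y → (y ∈? M) ×-dec ¬? (y ∈? X₀))
      ... | yes h = h
      ... | no none = ⊥-elim (Inside.impossible m
        (λ {x} x∈ → decidable-stable (x ∈? X₀) λ x∉ → none (x , x∈ , x∉)) ¬te)

-- Packings of co-modules

elements : ∀ {n} → Subset n → List (Fin n)
elements [] = []
elements (true ∷ p) = Fin.zero ∷ map Fin.suc (elements p)
elements (false ∷ p) = map Fin.suc (elements p)

length-elements : ∀ {n} (p : Subset n) → length (elements p) ≡ ∣ p ∣
length-elements [] = refl
length-elements (true ∷ p) = cong suc (trans (length-map Fin.suc (elements p)) (length-elements p))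
length-elements (false ∷ p) = trans (length-map Fin.suc (elements p)) (length-elements p)

elements-∈ : ∀ {n} (p : Subset n) → All (_∈ p) (elements p)
elements-∈ [] = []
elements-∈ (true ∷ p) = here ∷ All.map⁺ (All.map there (elements-∈ p))
elements-∈ (false ∷ p) = All.map⁺ (All.map there (elements-∈ p))

elements-pairs : ∀ {n} (p : Subset n) → AllPairs (λ x y → x ∈ p × y ∈ p × x ≢ y) (elements p)
elements-pairs [] = []
elements-pairs (true ∷ p) =
  All.map⁺ (All.map (λ y∈ → here , there y∈ , λ ()) (elements-∈ p)) ∷
  AllPairs.map⁺ (AllPairs.map (λ (x∈ , y∈ , x≢y) → there x∈ , there y∈ , λ { refl → x≢y refl }) (elements-pairs p))
elements-pairs (false ∷ p) =
  AllPairs.map⁺ (AllPairs.map (λ (x∈ , y∈ , x≢y) → there x∈ , there y∈ , λ { refl → x≢y refl }) (elements-pairs p))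

packing≤transversal : ∀ {n} (R : Subset n) (Ms : List (Subset n)) →
  All (λ M → Nonempty (M ∩ R)) Ms → AllPairs (λ M N → Empty (M ∩ N)) Ms → length Ms ≤ ∣ R ∣
packing≤transversal R [] _ _ = z≤n
packing≤transversal R (M ∷ Ms) ((x , x∈) ∷ hit) (disjoint ∷ rest) =
  -- The point x that hits M lies in no other member, so the rest is still hit after its removal.
  ≤-trans (s≤s (packing≤transversal (R - x) Ms (All.zipWith (λ (e , h) → avoid e h) (disjoint , hit)) rest))
    (x∈p⇒∣p-x∣<∣p∣ (proj₂ (x∈p∩q⁻ M R x∈)))
  where
  avoid : ∀ {N} → Empty (M ∩ N) → Nonempty (N ∩ R) → Nonempty (N ∩ (R - x))
  avoid {N} empty (y , y∈) with x∈p∩q⁻ N R y∈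
  ... | y∈N , y∈R = y , x∈p∩q⁺ (y∈N , x∈p∧x≢y⇒x∈p-y y∈R
    λ { refl → empty (y , x∈p∩q⁺ (proj₁ (x∈p∩q⁻ M R x∈) , y∈N)) })

module _ {n : ℕ} (T : Tournament n) where

  nontrivial-Inv : ∀ {X K} → NontrivialModule T K → (∀ {x v} → x ∈ K → v ∉ K → ¬ (v ∈ X × x ∈ X)) →
    NontrivialModule (Inv T X) K
  nontrivial-Inv {X} (nontrivial uni p∈ q∈ p≢q r∉) untouched = nontrivial
    (λ x∈ y∈ v∉ → trans (inv-kept T X (untouched x∈ v∉)) (trans (uni x∈ y∈ v∉) (sym (inv-kept T X (untouched y∈ v∉)))))
    p∈ q∈ p≢q r∉

  -- If X misses M, no arc between M and its complement is reversed, so whichever of the two is a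
  -- module survives.
  indecomposable⇒meets : ∀ {X M} → Indecomposable (Inv T X) → CoModule T M → Nonempty (M ∩ X)
  indecomposable⇒meets {X} {M} ind co with nonempty? (M ∩ X)
  ... | yes h = h
  ... | no empty = ⊥-elim (contra co)
    where
    decomposed : ∀ {K} → NontrivialModule (Inv T X) K → ⊥
    decomposed m = let mod , ¬triv = nontrivial⇒𝓜 (Inv T X) m in ¬triv (ind _ mod)

    contra : CoModule T M → ⊥
    contra (inj₁ m) = decomposed (nontrivial-Inv (𝓜⇒nontrivial T m)
      λ x∈ _ (_ , x∈X) → empty (_ , x∈p∩q⁺ (x∈ , x∈X)))
    contra (inj₂ m) = decomposed (nontrivial-Inv (𝓜⇒nontrivial T m)
      λ _ v∉ (v∈X , _) → empty (_ , x∈p∩q⁺ (x∉∁p⇒x∈p v∉ , v∈X)))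

  module _ {X : Subset n} (V : Valid T X) where
    open Valid V

    packing : List (Subset n)
    packing = map rep (elements X)

    length-packing : length packing ≡ ∣ X ∣
    length-packing = trans (length-map rep (elements X)) (length-elements X)

    packing-disjoint : DisjointCoModules T packing
    packing-disjoint =
        AllPairs.map⁺ (AllPairs.map (λ { {x} {y} (x∈ , y∈ , x≢y) eq →
          disj x∈ y∈ x≢y (∈rep x∈) (subst (x ∈_) eq (∈rep x∈)) }) (elements-pairs X))
      , All.map⁺ (All.map (proj₁ ∘ rep-mc) (elements-∈ X))
      , AllPairs.map⁺ (AllPairs.map (λ { {x} {y} (x∈ , y∈ , x≢y) (v , v∈) →
          let v∈x , v∈y = x∈p∩q⁻ (rep x) (rep y) v∈ in disj x∈ y∈ x≢y v∈x v∈y }) (elements-pairs X))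

    packing≤ : ∀ {R} → Transversal (mc T) R → ∣ X ∣ ≤ ∣ R ∣
    packing≤ {R} tv = ≤-trans (≤-reflexive (sym length-packing))
      (packing≤transversal R packing (All.map⁺ (All.map (tv _ ∘ rep-mc) (elements-∈ X)))
        (proj₂ (proj₂ packing-disjoint)))

    valid⇒tr : tr T X
    valid⇒tr = (transversal , exact) , (transversal , λ _ → packing≤) , bipartite
      where
      transversal : Transversal (mc T) X
      transversal F mcF = let x , x∈X , x∈F = meets mcF in x , x∈p∩q⁺ (x∈F , x∈X)

      exact : ∀ F → mc T F → ∣ F ∩ X ∣ ≡ 1
      exact F mcF with meets mcF
      ... | x , x∈X , x∈F = trans (cong ∣_∣ {x = F ∩ X} {y = ⁅ x ⁆} (⊆-antisym
          (λ {y} y∈ → let y∈F , y∈X = x∈p∩q⁻ F X y∈ in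
            subst (_∈ ⁅ x ⁆) (once mcF x∈X y∈X x∈F y∈F) (x∈⁅x⁆ x))
          (λ {y} y∈ → subst (_∈ F ∩ X) (sym (x∈⁅y⁆⇒x≡y x y∈)) (x∈p∩q⁺ (x∈F , x∈X)))))
        (∣⁅x⁆∣≡1 x)

      bipartite : StrictlyBipartiteBy (𝓜 T) X
      bipartite F m =
        let mF = 𝓜⇒nontrivial T m
            x , x∈X , x∈F = meets-module mF
            y , y∈X , y∉F = meets-outside mF
            z , z∈F , z∉X = covers mF
        in (x , x∈p∩q⁺ (x∈X , x∈F)) , (y , x∈p∧x∉q⇒x∈p─q y∈X y∉F) , (z , x∈p∧x∉q⇒x∈p─q z∈F z∉X)

    valid⇒comodularIndex : IsCoModularIndex T ∣ X ∣
    valid⇒comodularIndex = (packing , packing-disjoint , length-packing) ,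
      λ { _ (Ms , (_ , co , disjoint) , refl) → packing≤transversal X Ms
          (All.map (λ c → let x , x∈X , x∈M = meets-comodule c in x , x∈p∩q⁺ (x∈M , x∈X)) co) disjoint }

    valid⇒decomposabilityIndex : Indecomposable (Inv T X) → IsDecomposabilityIndex T ∣ X ∣
    valid⇒decomposabilityIndex ind = (X , refl , ind) ,
      λ { _ (Y , refl , ind′) → packing≤ λ _ mcF → indecomposable⇒meets ind′ (proj₁ mcF) }

theorem4p1 : ∀ (n : ℕ) (T : Tournament n) →
    5 ≤ n →
    ¬ (IsTransitive T × 2 ∣ n) →
    (∃[ X ] (tr T X × Indecomposable (Inv T X)))
    × (∃[ m ] (IsCoModularIndex T m × IsDecomposabilityIndex T m))
theorem4p1 n T 5≤n ¬te =
  let X , V , ind = improve T 5≤n (valid₀ T 5≤n ¬te)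
  in (X , valid⇒tr T V , ind) ,
     (∣ X ∣ , valid⇒comodularIndex T V , valid⇒decomposabilityIndex T V ind)
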